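{- Let $\mathcal{T}=(P,Q,\epsilon_1,\epsilon_2)$ be a Pultr template. Suppose that $(\mathcal{F},H)$ is a homomorphism duality. For a digraph $K$, consider the property $$(\ast)\qquad \text{for any digraph } G:\quad \Gamma_{\mathcal{T}}(G)\to H \iff G\to K.$$ (1) If $K$ is a digraph satisfying $(\ast)$, then $\{\Lambda_{\mathcal{T}}(F) : F\in\mathcal{F}\}$ is a complete set of obstructions for $K$. Assume, moreover, that $P$ and $Q$ are homomorphically equivalent to trees and that for any tree $T$, $\Lambda_{\mathcal{T}}(T)$ is homomorphically equivalent to a tree. Then: (2) If $H$ has tree duality and $K$ is a digraph satisfying $(\ast)$, then $K$ also has tree duality. (3) If $H$ has finite duality, then there exists a digraph $K$ that satisfies $(\ast)$. Moreover, $K$ also has finite duality.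
   Context: A digraph $G$ is a finite vertex set $V(G)$ (possibly empty) with an arc set $A(G)\subseteq V(G)\times V(G)$ (loops allowed). A homomorphism is an arc-preserving map of vertices; $G\to H$ means that a homomorphism of $G$ to $H$ exists, $G\nrightarrow H$ that none exists; $G$ and $H$ are homomorphically equivalent if $G\to H$ and $H\to G$. A tree is a digraph obtained by orienting each edge of a (nonempty, finite) undirected tree in exactly one direction. A Pultr template is a quadruple $\mathcal{T}=(P,Q,\epsilon_1,\epsilon_2)$ where $P,Q$ are digraphs and $\epsilon_1,\epsilon_2$ are homomorphisms of $P$ to $Q$. Central Pultr functor: for a digraph $H$, the vertices of $\Gamma_{\mathcal{T}}(H)$ are the homomorphisms $g:P\to H$, and the arcs are the couples $(g_1,g_2)$ for which there exists a homomorphism $h:Q\to H$ with $g_1=h\circ\epsilon_1$ and $g_2=h\circ\epsilon_2$. Left Pultr functor: for a digraph $G$, $\Lambda_{\mathcal{T}}(G)$ is obtained from the disjoint union of one copy $P_u$ of $P$ for every vertex $u$ of $G$ and one copy $Q_{u,v}$ of $Q$ for every arc $(u,v)$ of $G$, by identifying, for every arc $(u,v)$ of $G$ and every vertex $x$ of $P$, the copy of $x$ in $P_u$ with the copy of $\epsilon_1(x)$ in $Q_{u,v}$, and the copy of $x$ in $P_v$ with the copy of $\epsilon_2(x)$ in $Q_{u,v}$ (quotient by the equivalence relation generated by these identifications, the arcs being the images of arcs). Let $\mathcal{F}$ be a set of digraphs and $H$ a digraph. $\mathcal{F}$ is a complete set of obstructions for $H$, equivalently $(\mathcal{F},H)$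 is a homomorphism duality, if for any digraph $G$: $G\to H$ if and only if $F\nrightarrow G$ for all $F\in\mathcal{F}$. $H$ has tree duality if it admits a complete set of obstructions all of whose elements are trees; $H$ has finite duality if it admits a finite complete set of obstructions. -}

module Defs where

open import Level using (0ℓ)
open import Data.Bool.Base using (Bool; T)
open import Data.Bool.Properties using (T?; T-irrelevant)
open import Data.Nat.Base using (ℕ; _+_; _^_)
open import Data.Fin.Base using (Fin; zero; suc; inject₁; fromℕ; finToFun; funToFin)
open import Data.Fin.Properties as Fin using (any?; all?; finToFun-funToFin)
open import Data.List.Base
  using (List; []; _∷_; _++_; map; concatMap; allFin; length; lookup; deduplicate)
import Data.List.Membership.Setoid as SetoidMembership
import Data.List.Membership.Setoid.Properties as SetoidMembershipₚ
open import Data.List.Membership.Propositional using (_∈_)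
open import Data.List.Membership.Propositional.Properties
  using (∈-map⁺; ∈-map⁻; ∈-++⁺ˡ; ∈-++⁺ʳ; ∈-concatMap⁺; ∈-allFin; ∈-lookup)
open import Data.List.Relation.Unary.All as All using (All; []; _∷_)
open import Data.List.Relation.Unary.AllPairs using (AllPairs; []; _∷_)
open import Data.List.Relation.Unary.Any as Any using (Any; here; there)
open import Data.List.Relation.Unary.Any.Properties using (lookup-index)
import Data.List.Relation.Unary.Unique.DecSetoid.Properties as Uniqueₚ
open import Data.Product.Base using (∃-syntax; Σ-syntax; _×_; _,_; proj₁; proj₂)
import Data.Product.Properties as Product
open import Data.Sum.Base using (_⊎_; inj₁; inj₂)
open import Function.Base using (_∘_; _on_)
open import Function.Bundles using (Inverse; _⇔_)
open import Function.Definitions using (Injective)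
open import Relation.Binary.Bundles using (Setoid; DecSetoid)
open import Relation.Binary.Construct.Closure.Equivalence as Eq using (EqClosure)
open import Relation.Binary.Construct.Closure.ReflexiveTransitive using (Star; ε; _◅_; _◅◅_)
open import Relation.Binary.Construct.Closure.Symmetric using (fwd; bwd)
open import Relation.Binary.Core using (Rel)
open import Relation.Binary.Definitions using (Decidable; DecidableEquality; Symmetric; Irreflexive)
open import Relation.Binary.PropositionalEquality
  using (_≡_; _≗_; refl; sym; trans; cong; cong₂; subst; setoid)
open import Relation.Nullary using (¬_; Dec; yes; no; contradiction)
open import Relation.Nullary.Decidable using (map′; ⌊_⌋; _×-dec_; _⊎-dec_; _→-dec_)
open import Relation.Unary using (Pred)

-- The arc set is given by its characteristic function, so a pair of vertices
-- carries at most one arc (`T b` has at most one element).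
record Digraph : Set where
  field
    order : ℕ
    arc   : Fin order → Fin order → Bool

  Vertex : Set
  Vertex = Fin order

  Arc : Rel Vertex 0ℓ
  Arc u v = T (arc u v)

open Digraph public

infix 4 _⟶_ _↮_ _≃ₕ_

record _⟶_ (G H : Digraph) : Set where
  field
    fun       : Vertex G → Vertex H
    preserves : ∀ {u v} → Arc G u v → Arc H (fun u) (fun v)

open _⟶_ public

_↮_ : Digraph → Digraph → Set
G ↮ H = ¬ (G ⟶ H)

_≃ₕ_ : Digraph → Digraph → Set
G ≃ₕ H = (G ⟶ H) × (H ⟶ G)

record Graph (n : ℕ) : Set where
  field
    edge             : Fin n → Fin n → Bool
    edge-symmetric   : Symmetric (λ u v → T (edge u v))
    edge-irreflexive : Irreflexive _≡_ (λ u v → T (edge u v))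

  Edge : Rel (Fin n) 0ℓ
  Edge u v = T (edge u v)

open Graph public

-- A cycle is a closed walk on k + 3 pairwise distinct vertices.
record Cycle {n : ℕ} (U : Graph n) : Set where
  field
    {k}      : ℕ
    vertex   : Fin (3 + k) → Fin n
    distinct : Injective _≡_ _≡_ vertex
    step     : ∀ i → Edge U (vertex (inject₁ i)) (vertex (suc i))
    close    : Edge U (vertex (fromℕ (2 + k))) (vertex zero)

record IsUndirectedTree {n : ℕ} (U : Graph n) : Set where
  field
    nonempty  : Fin n
    connected : ∀ u v → Star (Edge U) u v
    acyclic   : ¬ Cycle U

record IsOrientationOf (D : Digraph) (U : Graph (order D)) : Set where
  field
    underlying   : ∀ u v → Edge U u v ⇔ (Arc D u v ⊎ Arc D v u)
    oneDirection : ∀ u v → Arc D u v → ¬ Arc D v u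

IsTree : Pred Digraph 0ℓ
IsTree D = Σ[ U ∈ Graph (order D) ] IsUndirectedTree U × IsOrientationOf D U

EquivalentToTree : Pred Digraph 0ℓ
EquivalentToTree G = ∃[ T ] IsTree T × G ≃ₕ T

-- Equivalently: (𝓕 , H) is a homomorphism duality.
IsCompleteSetOfObstructions : Pred Digraph 0ℓ → Digraph → Set
IsCompleteSetOfObstructions 𝓕 H = ∀ G → (G ⟶ H) ⇔ (∀ F → 𝓕 F → F ↮ G)

HasTreeDuality : Digraph → Set₁
HasTreeDuality H =
  Σ[ 𝓕 ∈ Pred Digraph 0ℓ ] (∀ F → 𝓕 F → IsTree F) × IsCompleteSetOfObstructions 𝓕 H

HasFiniteDuality : Digraph → Set
HasFiniteDuality H = Σ[ Fs ∈ List Digraph ] IsCompleteSetOfObstructions (_∈ Fs) H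

-- A numbering of the equivalence classes of S.
record Finite (S : Setoid 0ℓ 0ℓ) : Set where
  field
    size      : ℕ
    numbering : Inverse S (setoid (Fin size))

  open Setoid S using (Carrier)

  class : Carrier → Fin size
  class = Inverse.to numbering

  representative : Fin size → Carrier
  representative = Inverse.from numbering

module _ (DS : DecSetoid 0ℓ 0ℓ) where

  private
    open DecSetoid DS renaming (setoid to S; refl to ≈-refl; sym to ≈-sym; trans to ≈-trans)
    module M = SetoidMembership S

    lookup-injective : ∀ {xs} → AllPairs (λ x y → ¬ x ≈ y) xs →
                       ∀ i j → lookup xs i ≈ lookup xs j → i ≡ j
    lookup-injective (_ ∷ _)  zero    zero    _  = refl
    lookup-injective (p ∷ _)  zero    (suc j) eq = contradiction eq (All.lookup p (∈-lookup j))
    lookup-injective (p ∷ _)  (suc i) zero    eq =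
      contradiction (≈-sym eq) (All.lookup p (∈-lookup i))
    lookup-injective (_ ∷ ps) (suc i) (suc j) eq = cong suc (lookup-injective ps i j eq)

  finite : (xs : List Carrier) → (∀ x → x M.∈ xs) → Finite S
  finite xs complete = record
    { size      = length reps
    ; numbering = record
      { to        = to
      ; from      = lookup reps
      ; to-cong   = λ {x} {y} x≈y →
          inj (to x) (to y) (≈-trans (from-to x) (≈-trans x≈y (≈-sym (from-to y))))
      ; from-cong = λ { refl → ≈-refl }
      ; inverse   =
          (λ {i} {x} x≈ → inj (to x) i (≈-trans (from-to x) x≈))
        , (λ { {x} refl → from-to x })
      }
    }
    where
    reps : List Carrier
    reps = deduplicate _≟_ xs

    member : ∀ x → x M.∈ reps
    member x = SetoidMembershipₚ.∈-deduplicate⁺ S _≟_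
      (λ z≈y x≈y → ≈-trans x≈y (≈-sym z≈y)) (complete x)

    to : Carrier → Fin (length reps)
    to x = Any.index (member x)

    inj : ∀ i j → lookup reps i ≈ lookup reps j → i ≡ j
    inj = lookup-injective (Uniqueₚ.deduplicate-! DS xs)

    from-to : ∀ x → lookup reps (to x) ≈ x
    from-to x = ≈-sym (lookup-index (member x))

homSetoid : Digraph → Digraph → Setoid 0ℓ 0ℓ
homSetoid G H = record
  { Carrier       = G ⟶ H
  ; _≈_           = _≗_ on fun
  ; isEquivalence = record
    { refl  = λ _ → refl
    ; sym   = λ p x → sym (p x)
    ; trans = λ p q x → trans (p x) (q x)
    }
  }

homDecSetoid : Digraph → Digraph → DecSetoid 0ℓ 0ℓ
homDecSetoid G H = record
  { isDecEquivalence = record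
    { isEquivalence = Setoid.isEquivalence (homSetoid G H)
    ; _≟_           = λ f g → all? (λ x → fun f x Fin.≟ fun g x)
    }
  }

module _ (G H : Digraph) where

  private
    module M = SetoidMembership (homSetoid G H)

    Preserves : (Vertex G → Vertex H) → Set
    Preserves f = ∀ u v → Arc G u v → Arc H (f u) (f v)

    preserves? : ∀ f → Dec (Preserves f)
    preserves? f = all? λ u → all? λ v → T? (arc G u v) →-dec T? (arc H (f u) (f v))

    toHoms : ∀ f → Dec (Preserves f) → List (G ⟶ H)
    toHoms f (yes p) = record { fun = f ; preserves = p _ _ } ∷ []
    toHoms f (no  _) = []

    candidate : Fin (order H ^ order G) → List (G ⟶ H)
    candidate k = toHoms (finToFun k) (preserves? (finToFun k))

    toHoms-∈ : ∀ f (d : Dec (Preserves f)) (g : G ⟶ H) → f ≗ fun g → g M.∈ toHoms f d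
    toHoms-∈ f (yes p) g eq = here (sym ∘ eq)
    toHoms-∈ f (no ¬p) g eq = contradiction
      (λ u v a → subst T (sym (cong₂ (arc H) (eq u) (eq v))) (preserves g a)) ¬p

  homs : List (G ⟶ H)
  homs = concatMap candidate (allFin (order H ^ order G))

  homs-complete : ∀ g → g M.∈ homs
  homs-complete g = go (∈-allFin (funToFin (fun g)))
    where
    go : ∀ {ks} → funToFin (fun g) ∈ ks → g M.∈ concatMap candidate ks
    go (here refl)      = SetoidMembershipₚ.∈-++⁺ˡ (homSetoid G H) {v = g}
      (toHoms-∈ _ (preserves? _) g (finToFun-funToFin (fun g)))
    go (there {k} k∈ks) = SetoidMembershipₚ.∈-++⁺ʳ (homSetoid G H) {v = g} (candidate k) (go k∈ks)

  homs-finite : Finite (homSetoid G H)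
  homs-finite = finite (homDecSetoid G H) homs homs-complete

module _ {A : Set} where

  private
    Listed : List (A × A) → Rel A 0ℓ
    Listed ps x y = (x , y) ∈ ps

    module _ {a b : A} {ps : List (A × A)} where

      _~_ : Rel A 0ℓ
      _~_ = EqClosure (Listed ps)

      ~-sym : ∀ {x y} → x ~ y → y ~ x
      ~-sym = Eq.symmetric (Listed ps)

      Merged : Rel A 0ℓ
      Merged x y = x ~ y ⊎ (x ~ a × b ~ y) ⊎ (x ~ b × a ~ y)

      prepend : ∀ {x y z} → x ~ y → Merged y z → Merged x z
      prepend p (inj₁ q)              = inj₁ (p ◅◅ q)
      prepend p (inj₂ (inj₁ (q , r))) = inj₂ (inj₁ (p ◅◅ q , r))
      prepend p (inj₂ (inj₂ (q , r))) = inj₂ (inj₂ (p ◅◅ q , r))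

      a→b : ∀ {z} → Merged b z → Merged a z
      a→b (inj₁ p)              = inj₂ (inj₁ (ε , p))
      a→b (inj₂ (inj₁ (p , q))) = inj₂ (inj₁ (ε , q))
      a→b (inj₂ (inj₂ (p , q))) = inj₁ q

      b→a : ∀ {z} → Merged a z → Merged b z
      b→a (inj₁ p)              = inj₂ (inj₂ (ε , p))
      b→a (inj₂ (inj₁ (p , q))) = inj₁ q
      b→a (inj₂ (inj₂ (p , q))) = inj₂ (inj₂ (ε , q))

      split : ∀ {x y} → EqClosure (Listed ((a , b) ∷ ps)) x y → Merged x y
      split ε                      = inj₁ ε
      split (fwd (here refl) ◅ rs) = a→b (split rs)
      split (bwd (here refl) ◅ rs) = b→a (split rs)
      split (fwd (there p)   ◅ rs) = prepend (fwd p ◅ ε) (split rs)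
      split (bwd (there p)   ◅ rs) = prepend (bwd p ◅ ε) (split rs)

      weaken : ∀ {x y} → x ~ y → EqClosure (Listed ((a , b) ∷ ps)) x y
      weaken = Eq.map there

      unsplit : ∀ {x y} → Merged x y → EqClosure (Listed ((a , b) ∷ ps)) x y
      unsplit (inj₁ p)              = weaken p
      unsplit (inj₂ (inj₁ (p , q))) = weaken p ◅◅ fwd (here refl) ◅ weaken q
      unsplit (inj₂ (inj₂ (p , q))) = weaken p ◅◅ bwd (here refl) ◅ weaken q

    listed? : DecidableEquality A → ∀ ps → Decidable (EqClosure (Listed ps))
    listed? _≟_ [] x y = map′ (λ { refl → ε }) empty (x ≟ y)
      where
      empty : ∀ {x y} → EqClosure (Listed []) x y → x ≡ y
      empty ε             = refl
      empty (fwd () ◅ _)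
      empty (bwd () ◅ _)
    listed? _≟_ ((a , b) ∷ ps) x y = map′ unsplit split
      ((x ~? y) ⊎-dec ((x ~? a) ×-dec (b ~? y)) ⊎-dec ((x ~? b) ×-dec (a ~? y)))
      where
      _~?_ = listed? _≟_ ps

  eqClosure? : DecidableEquality A → (R : Rel A 0ℓ) (rs : List (∃[ p ] R (proj₁ p) (proj₂ p))) →
               (∀ {x y} (r : R x y) → ((x , y) , r) ∈ rs) → Decidable (EqClosure R)
  eqClosure? _≟_ R rs complete x y = map′ (Eq.map sound) (Eq.map (∈-map⁺ proj₁ ∘ complete))
    (listed? _≟_ (map proj₁ rs) x y)
    where
    sound : ∀ {x y} → (x , y) ∈ map proj₁ rs → R x y
    sound p∈ with ∈-map⁻ proj₁ p∈
    ... | ((_ , r) , _ , refl) = r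

private
  concatMap-∈ : ∀ {A B : Set} (f : A → List B) {x y xs} →
                x ∈ xs → y ∈ f x → y ∈ concatMap f xs
  concatMap-∈ f x∈xs y∈ = ∈-concatMap⁺ f (Any.map (λ { refl → y∈ }) x∈xs)

record PultrTemplate : Set where
  field
    P Q   : Digraph
    ε₁ ε₂ : P ⟶ Q

module _ (𝒯 : PultrTemplate) where

  open PultrTemplate 𝒯

  Γ-Arc : ∀ H → Rel (P ⟶ H) 0ℓ
  Γ-Arc H g₁ g₂ = Σ[ h ∈ (Q ⟶ H) ] fun g₁ ≗ fun h ∘ fun ε₁ × fun g₂ ≗ fun h ∘ fun ε₂

  Γ-Arc? : ∀ H → Decidable (Γ-Arc H)
  Γ-Arc? H g₁ g₂ = map′ Any.satisfied
    (λ { (h , p , q) → Any.map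
      (λ h≗h′ → (λ x → trans (p x) (h≗h′ _)) , (λ x → trans (q x) (h≗h′ _)))
      (homs-complete Q H h) })
    (Any.any? (λ h → all? (λ x → fun g₁ x Fin.≟ fun h (fun ε₁ x))
               ×-dec all? (λ x → fun g₂ x Fin.≟ fun h (fun ε₂ x)))
              (homs Q H))

  -- Vertices are numbers of homomorphisms P ⟶ H, taken up to pointwise equality.
  Γ : Digraph → Digraph
  Γ H = record
    { order = size
    ; arc   = λ i j → ⌊ Γ-Arc? H (representative i) (representative j) ⌋
    }
    where open Finite (homs-finite P H)

  data Copy (G : Digraph) : Set where
    P-copy : Vertex G → Copy G
    Q-copy : ∀ u v → Arc G u v → Copy G

  piece : ∀ {G} → Copy G → Digraph
  piece (P-copy _)     = P
  piece (Q-copy _ _ _) = Q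

  -- The vertices of the disjoint union of all the copies.
  Point : Digraph → Set
  Point G = Σ[ c ∈ Copy G ] Vertex (piece c)

  data Glue (G : Digraph) : Rel (Point G) 0ℓ where
    glue₁ : ∀ {u v} (a : Arc G u v) (x : Vertex P) →
            Glue G (P-copy u , x) (Q-copy u v a , fun ε₁ x)
    glue₂ : ∀ {u v} (a : Arc G u v) (x : Vertex P) →
            Glue G (P-copy v , x) (Q-copy u v a , fun ε₂ x)

  Λ-setoid : Digraph → Setoid 0ℓ 0ℓ
  Λ-setoid G = Eq.setoid (Glue G)

  module _ (G : Digraph) where

    private
      _≟-copy_ : DecidableEquality (Copy G)
      P-copy u     ≟-copy P-copy u′       = map′ (cong P-copy) (λ { refl → refl }) (u Fin.≟ u′)
      P-copy _     ≟-copy Q-copy _ _ _    = no λ ()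
      Q-copy _ _ _ ≟-copy P-copy _        = no λ ()
      Q-copy u v a ≟-copy Q-copy u′ v′ a′ with u Fin.≟ u′ | v Fin.≟ v′
      ... | yes refl | yes refl = yes (cong (Q-copy u v) (T-irrelevant a a′))
      ... | no u≢    | _        = no λ { refl → u≢ refl }
      ... | yes _    | no v≢    = no λ { refl → v≢ refl }

      ifArc : ∀ u v → Dec (Arc G u v) → List (∃[ p ] Arc G (proj₁ p) (proj₂ p))
      ifArc u v (yes a) = ((u , v) , a) ∷ []
      ifArc u v (no  _) = []

      ∈-ifArc : ∀ {u v} (d : Dec (Arc G u v)) a → ((u , v) , a) ∈ ifArc u v d
      ∈-ifArc (yes a′) a = here (cong (_ ,_) (T-irrelevant a a′))
      ∈-ifArc (no ¬a)  a = contradiction a ¬a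

      arcs : List (∃[ p ] Arc G (proj₁ p) (proj₂ p))
      arcs = concatMap (λ u → concatMap (λ v → ifArc u v (T? (arc G u v))) (allFin _)) (allFin _)

      arcs-complete : ∀ {u v} (a : Arc G u v) → ((u , v) , a) ∈ arcs
      arcs-complete {u} {v} a =
        concatMap-∈ _ (∈-allFin u) (concatMap-∈ _ (∈-allFin v) (∈-ifArc (T? (arc G u v)) a))

      copies : List (Copy G)
      copies = map P-copy (allFin _) ++ map (λ { ((u , v) , a) → Q-copy u v a }) arcs

      copies-complete : ∀ c → c ∈ copies
      copies-complete (P-copy u)     = ∈-++⁺ˡ (∈-map⁺ P-copy (∈-allFin u))
      copies-complete (Q-copy u v a) = ∈-++⁺ʳ _ (∈-map⁺ _ (arcs-complete a))

      points : List (Point G)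
      points = concatMap (λ c → map (c ,_) (allFin _)) copies

      points-complete : ∀ p → p ∈ points
      points-complete (c , x) =
        concatMap-∈ _ (copies-complete c) (∈-map⁺ (c ,_) (∈-allFin x))

      gluings : List (∃[ p ] Glue G (proj₁ p) (proj₂ p))
      gluings = concatMap (λ { (_ , a) →
        concatMap (λ x → (_ , glue₁ a x) ∷ (_ , glue₂ a x) ∷ []) (allFin _) }) arcs

      gluings-complete : ∀ {p q} (g : Glue G p q) → ((p , q) , g) ∈ gluings
      gluings-complete (glue₁ a x) =
        concatMap-∈ _ (arcs-complete a) (concatMap-∈ _ (∈-allFin x) (here refl))
      gluings-complete (glue₂ a x) =
        concatMap-∈ _ (arcs-complete a) (concatMap-∈ _ (∈-allFin x) (there (here refl)))

    Λ-decSetoid : DecSetoid 0ℓ 0ℓ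
    Λ-decSetoid = record
      { isDecEquivalence = record
        { isEquivalence = Setoid.isEquivalence (Λ-setoid G)
        ; _≟_ = eqClosure? (Product.≡-dec _≟-copy_ Fin._≟_) (Glue G) gluings gluings-complete
        }
      }

    Λ-finite : Finite (Λ-setoid G)
    Λ-finite = finite Λ-decSetoid points
      (λ p → Any.map (λ { refl → ε }) (points-complete p))

    open Finite Λ-finite

    Λ-Arc : Rel (Fin size) 0ℓ
    Λ-Arc i j = Σ[ c ∈ Copy G ] ∃[ x ] ∃[ y ]
      Arc (piece c) x y × class (c , x) ≡ i × class (c , y) ≡ j

    Λ-Arc? : Decidable Λ-Arc
    Λ-Arc? i j = map′ Any.satisfied
      (λ { (c , w) → Any.map (λ { refl → w }) (copies-complete c) })
      (Any.any? (λ c → any? λ x → any? λ y →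
                   T? (arc (piece c) x y) ×-dec class (c , x) Fin.≟ i ×-dec class (c , y) Fin.≟ j)
                copies)

    -- Vertices are numbers of the classes of points under the closure of Glue.
    Λ : Digraph
    Λ = record
      { order = size
      ; arc   = λ i j → ⌊ Λ-Arc? i j ⌋
      }

  Λ-image : Pred Digraph 0ℓ → Pred Digraph 0ℓ
  Λ-image 𝓕 L = ∃[ F ] 𝓕 F × L ≡ Λ F

  Property⋆ : Digraph → Digraph → Set
  Property⋆ H K = ∀ G → (Γ G ⟶ H) ⇔ (G ⟶ K)

{-# OPTIONS --safe #-}

-- (1) and (2) follow from the adjunction ΛF → G ⇔ F → ΓG. For (3):
--
-- If H has finite duality, replace its obstructions by connected cores, and let A be one of them
-- having an arc e that lies on a cycle. Glue together many copies of A along a shift graph, e leading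
-- from one copy to another. As shift graphs have large chromatic number, the result does not map to H,
-- so some obstruction F maps to it; as shift graphs are locally directed paths, F → A then carries a
-- level that drops along e only. If also A → F, the core A itself would carry such a level, which the
-- cycle through e forbids. Hence F lies strictly below A, and below each obstruction there is one
-- whose arcs are all bridges, that is, a tree.
--
-- Conversely, finitely many trees have a dual, the product of the duals of the single trees. Applied
-- to trees equivalent to the ΛT, for T in a finite family of tree obstructions of H, this yields K.

module Submission where

open import Defs
open import Level using (0ℓ)
open import Data.Bool.Base using (true; _∨_)
open import Data.Bool.Properties using (T?; T-irrelevant; T-∨)
open import Data.Empty using (⊥)
open import Data.Fin.Base as Fin
  using (Fin; zero; suc; toℕ; inject₁; fromℕ; finToFun; funToFin; combine; remQuot)
open import Data.Fin.Properties as Fin using (any?; all?; finToFun-funToFin; remQuot-combine; pigeonhole)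
open import Data.List.Base
  using (List; []; _∷_; length; filter; lookup; allFin; concatMap; cartesianProduct)
open import Data.List.Membership.Propositional using (_∈_; lose; find)
open import Data.List.Membership.Propositional.Properties
  using (∈-filter⁺; ∈-filter⁻; ∈-lookup; ∈-allFin; ∈-concatMap⁺; ∈-cartesianProduct⁺)
open import Data.List.Properties using (filter-notAll; length-filter; length-tabulate)
open import Data.List.Relation.Unary.Any as Any using (Any; here; there)
open import Data.List.Relation.Unary.Any.Properties using (lookup-index)
open import Data.Nat.Base as ℕ using (ℕ; zero; suc; _+_; _*_; _^_; _≤_; _<_; z≤n; s≤s)
import Data.Nat.Properties as ℕ
open import Data.Product.Base using (∃-syntax; Σ-syntax; _×_; _,_; proj₁; proj₂)
open import Data.Sum.Base as Sum using (_⊎_; inj₁; inj₂; [_,_]′)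
open import Data.Unit.Base using (tt)
open import Data.Vec.Base as Vec using (Vec; []; _∷_; tabulate)
open import Data.Vec.Properties as Vec using (tabulate-cong; tabulate∘lookup)
open import Data.Vec.Relation.Unary.All as VecAll using ([]; _∷_)
open import Data.Vec.Relation.Unary.AllPairs as VecAllPairs using (AllPairs; []; _∷_)
open import Data.Vec.Relation.Unary.Unique.Propositional.Properties using (lookup-injective)
open import Function.Base using (_∘_; id)
open import Function.Bundles using (Inverse; Equivalence; _⇔_; mk⇔)
open import Function.Definitions using (Injective)
open import Relation.Binary.Construct.Closure.Equivalence as Eq using (EqClosure)
open import Relation.Binary.Construct.Closure.ReflexiveTransitive as Star using (Star; ε; _◅_; _◅◅_)
open import Relation.Binary.Construct.Closure.Symmetric using (SymClosure; fwd; bwd)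
open import Relation.Binary.Core using (Rel)
open import Relation.Binary.Definitions using (Decidable; tri<; tri≈; tri>)
open import Relation.Binary.PropositionalEquality
open import Relation.Nullary using (¬_; Dec; yes; no; contradiction; ¬?)
open import Relation.Nullary.Decidable
  using (⌊_⌋; toWitness; fromWitness; _×-dec_; _→-dec_; _⊎-dec_; map′; decidable-stable)
open import Relation.Unary using (Pred)
import Relation.Unary as Unary

open Equivalence using (to; from)

-- Homomorphisms and the Pultr adjunction

import Relation.Unary as Unary

infixr 9 _∘ₕ_

idₕ : ∀ {G} → G ⟶ G
idₕ = record { fun = id ; preserves = id }

_∘ₕ_ : ∀ {G H K} → H ⟶ K → G ⟶ H → G ⟶ K
g ∘ₕ f = record { fun = fun g ∘ fun f ; preserves = preserves g ∘ preserves f }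

hom? : ∀ G H → Dec (G ⟶ H)
hom? G H = decide (homs G H) (homs-complete G H)
  where
  decide : (gs : List (G ⟶ H)) → (∀ g → Any (λ h → ∀ x → fun g x ≡ fun h x) gs) → Dec (G ⟶ H)
  decide []      complete = no λ g → contradiction (complete g) λ ()
  decide (g ∷ _) _        = yes g

-- Finiteness is what makes this constructive: existence of homomorphisms is decidable, so an
-- obstruction mapping to `G` can be searched for in the list.
obstruction : ∀ {Fs H} → IsCompleteSetOfObstructions (_∈ Fs) H →
              ∀ {G} → G ↮ H → ∃[ F ] F ∈ Fs × F ⟶ G
obstruction {Fs} complete {G} G↮H with Any.any? (λ F → hom? F G) Fs
... | yes F⟶G = find F⟶G
... | no  ¬F⟶G = contradiction (from (complete G) λ F F∈ F⟶G → ¬F⟶G (lose F∈ F⟶G)) G↮H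

obstruction-↮ : ∀ {𝓕 H} → IsCompleteSetOfObstructions 𝓕 H → ∀ {F} → 𝓕 F → F ↮ H
obstruction-↮ complete {F} F∈𝓕 F⟶H = to (complete F) F⟶H F F∈𝓕 idₕ

module _ (𝒯 : PultrTemplate) where

  open PultrTemplate 𝒯

  -- Restrict `ψ` to the pieces: the copy of `P` at `u` gives the image of `u`, and the copy of `Q`
  -- at an arc witnesses the arc in `Γ`, since glued points have the same image.
  Λ⟶⇒⟶Γ : ∀ {F G} → Λ 𝒯 F ⟶ G → F ⟶ Γ 𝒯 G
  Λ⟶⇒⟶Γ {F} {G} ψ = record
    { fun       = λ u → H.class (P-hom u)
    ; preserves = λ {u} {v} a → fromWitness
        {a? = Γ-Arc? 𝒯 G (H.representative (H.class (P-hom u))) (H.representative (H.class (P-hom v)))}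
        ( Q-hom a
        , (λ x → trans (H.rep-class (P-hom u) x) (cong (fun ψ) (L.class-cong (fwd (glue₁ a x) ◅ ε))))
        , (λ x → trans (H.rep-class (P-hom v) x) (cong (fun ψ) (L.class-cong (fwd (glue₂ a x) ◅ ε)))))
    }
    where
    module L where
      open Finite (Λ-finite 𝒯 F) public
      class-cong : ∀ {p q} → EqClosure (Glue 𝒯 F) p q → class p ≡ class q
      class-cong = Inverse.to-cong numbering
    module H where
      open Finite (homs-finite P G) public
      rep-class : ∀ g x → fun (representative (class g)) x ≡ fun g x
      rep-class g = Inverse.strictlyInverseʳ numbering g

    piece-hom : (c : Copy 𝒯 F) → piece 𝒯 c ⟶ G
    piece-hom c = record
      { fun       = λ x → fun ψ (L.class (c , x))
      ; preserves = λ a → preserves ψ (fromWitness {a? = Λ-Arc? 𝒯 F _ _} (c , _ , _ , a , refl , refl))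
      }

    P-hom : Vertex F → P ⟶ G
    P-hom u = piece-hom (P-copy u)

    Q-hom : ∀ {u v} → Arc F u v → Q ⟶ G
    Q-hom a = piece-hom (Q-copy _ _ a)

  -- The homomorphisms named by `ψ` on the copies of `P` and the witnesses of its arcs on the copies
  -- of `Q` agree on glued points, so together they factor through the quotient.
  ⟶Γ⇒Λ⟶ : ∀ {F G} → F ⟶ Γ 𝒯 G → Λ 𝒯 F ⟶ G
  ⟶Γ⇒Λ⟶ {F} {G} ψ = record
    { fun       = point-map ∘ L.representative
    ; preserves = λ a → Λ-Arc-preserved (toWitness {a? = Λ-Arc? 𝒯 F _ _} a)
    }
    where
    module L = Finite (Λ-finite 𝒯 F)
    module H = Finite (homs-finite P G)

    Γ-arc : ∀ {u v} (a : Arc F u v) →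
            Γ-Arc 𝒯 G (H.representative (fun ψ u)) (H.representative (fun ψ v))
    Γ-arc {u} {v} a = toWitness
      {a? = Γ-Arc? 𝒯 G (H.representative (fun ψ u)) (H.representative (fun ψ v))} (preserves ψ a)

    piece-hom : (c : Copy 𝒯 F) → piece 𝒯 c ⟶ G
    piece-hom (P-copy u)     = H.representative (fun ψ u)
    piece-hom (Q-copy _ _ a) = proj₁ (Γ-arc a)

    point-map : Point 𝒯 F → Vertex G
    point-map (c , x) = fun (piece-hom c) x

    glue-respected : ∀ {p q} → Glue 𝒯 F p q → point-map p ≡ point-map q
    glue-respected (glue₁ a x) = proj₁ (proj₂ (Γ-arc a)) x
    glue-respected (glue₂ a x) = proj₂ (proj₂ (Γ-arc a)) x

    representative-class : ∀ p → point-map (L.representative (L.class p)) ≡ point-map p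
    representative-class p = Eq.gfold isEquivalence point-map glue-respected
      (Inverse.strictlyInverseʳ L.numbering p)

    Λ-Arc-preserved : ∀ {i j} → Λ-Arc 𝒯 F i j →
                      Arc G (point-map (L.representative i)) (point-map (L.representative j))
    Λ-Arc-preserved (c , x , y , a , refl , refl) =
      subst₂ (Arc G) (sym (representative-class (c , x))) (sym (representative-class (c , y)))
        (preserves (piece-hom c) a)

  Λ-image-complete : ∀ {𝓕 H K} → IsCompleteSetOfObstructions 𝓕 H → Property⋆ 𝒯 H K →
                     IsCompleteSetOfObstructions (Λ-image 𝒯 𝓕) K
  Λ-image-complete complete K⋆ G = mk⇔
    (λ { G⟶K _ (F , F∈𝓕 , refl) ΛF⟶G → to (complete (Γ 𝒯 G)) (from (K⋆ G) G⟶K) F F∈𝓕 (Λ⟶⇒⟶Γ ΛF⟶G) })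
    (λ ΛF↮G → to (K⋆ G) (from (complete (Γ 𝒯 G)) λ F F∈𝓕 → ΛF↮G (Λ 𝒯 F) (F , F∈𝓕 , refl) ∘ ⟶Γ⇒Λ⟶))

  Λ-treeDuality : (∀ T → IsTree T → EquivalentToTree (Λ 𝒯 T)) → ∀ {H} → HasTreeDuality H →
                  ∀ {K} → Property⋆ 𝒯 H K → HasTreeDuality K
  Λ-treeDuality Λ-tree {H} (𝓕 , 𝓕-trees , complete) {K} K⋆ =
    𝓣 , (λ _ → proj₁) , λ G → mk⇔
      (λ { G⟶K T (_ , F , F∈𝓕 , (_ , ΛF⟶T)) T⟶G →
           to (Λ-complete G) G⟶K (Λ 𝒯 F) (F , F∈𝓕 , refl) (T⟶G ∘ₕ ΛF⟶T) })
      (λ T↮G → from (Λ-complete G) λ { _ (F , F∈𝓕 , refl) ΛF⟶G →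
         let T , T-tree , ΛF⟶T , T⟶ΛF = Λ-tree F (𝓕-trees F F∈𝓕)
         in T↮G T (T-tree , F , F∈𝓕 , T⟶ΛF , ΛF⟶T) (ΛF⟶G ∘ₕ T⟶ΛF) })
    where
    𝓣 : Pred Digraph 0ℓ
    𝓣 T = IsTree T × ∃[ F ] 𝓕 F × T ≃ₕ Λ 𝒯 F
    Λ-complete = Λ-image-complete complete K⋆

-- Finite digraphs, counting and cycles

-- Vertices have to be numbers, so structured vertices such as functions, tuples and pairs enter
-- through `decode`.
module CodeDigraph {A : Set} {R : Rel A 0ℓ} (n : ℕ) (decode : Fin n → A) (R? : Decidable R) where

  digraph : Digraph
  digraph = record { order = n ; arc = λ i j → ⌊ R? (decode i) (decode j) ⌋ }

  arc⁺ : ∀ i j → R (decode i) (decode j) → Arc digraph i j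
  arc⁺ i j = fromWitness {a? = R? (decode i) (decode j)}

  arc⁻ : ∀ i j → Arc digraph i j → R (decode i) (decode j)
  arc⁻ i j = toWitness {a? = R? (decode i) (decode j)}

module Filtered {n} {P : Pred (Fin n) 0ℓ} (P? : Unary.Decidable P) where

  members : List (Fin n)
  members = filter P? (allFin n)

  size : ℕ
  size = length members

  member : Fin size → Fin n
  member = lookup members

  member-satisfies : ∀ i → P (member i)
  member-satisfies i = proj₂ (∈-filter⁻ P? {xs = allFin n} (∈-lookup i))

  index : ∀ v → P v → Fin size
  index v p = Any.index (∈-filter⁺ P? (∈-allFin v) p)

  member-index : ∀ v p → member (index v p) ≡ v
  member-index v p = sym (lookup-index (∈-filter⁺ P? (∈-allFin v) p))

  size< : ∀ {v} → ¬ P v → size < n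
  size< {v} ¬p = subst (size <_) (length-tabulate id)
    (filter-notAll P? (allFin n) (lose (∈-allFin v) ¬p))

module _ {A : Set} {P Q : Pred A 0ℓ} (P? : Unary.Decidable P) (Q? : Unary.Decidable Q)
         (P⊆Q : ∀ {x} → P x → Q x) where

  length-filter-mono : ∀ xs → length (filter P? xs) ≤ length (filter Q? xs)
  length-filter-mono []       = z≤n
  length-filter-mono (x ∷ xs) with P? x | Q? x
  ... | yes p | yes q = s≤s (length-filter-mono xs)
  ... | yes p | no ¬q = contradiction (P⊆Q p) ¬q
  ... | no ¬p | yes q = ℕ.m≤n⇒m≤1+n (length-filter-mono xs)
  ... | no ¬p | no ¬q = length-filter-mono xs

  length-filter-mono-< : ∀ {x xs} → x ∈ xs → Q x → ¬ P x →
                         length (filter P? xs) < length (filter Q? xs)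
  length-filter-mono-< {x} {xs = _ ∷ xs} (here refl) q ¬p with P? x | Q? x
  ... | yes p | _     = contradiction p ¬p
  ... | no _  | yes _ = s≤s (length-filter-mono xs)
  ... | no _  | no ¬q = contradiction q ¬q
  length-filter-mono-< {xs = y ∷ xs} (there x∈) q ¬p with P? y | Q? y
  ... | yes p | yes q′ = s≤s (length-filter-mono-< x∈ q ¬p)
  ... | yes p | no ¬q  = contradiction (P⊆Q p) ¬q
  ... | no _  | yes _  = ℕ.m≤n⇒m≤1+n (length-filter-mono-< x∈ q ¬p)
  ... | no _  | no _   = length-filter-mono-< x∈ q ¬p

module _ {A : Set} {R : ℕ → Pred A 0ℓ} (R? : ∀ d → Unary.Decidable (R d))
         (R-grows : ∀ d {x} → R d x → R (suc d) x) (xs : List A) where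

  -- Each stage that is not stable admits a new element of `xs`, which can happen at most
  -- `length xs` times; in `search`, `k` bounds the admissions still possible.
  stabilises : ∃[ d ] (∀ {x} → x ∈ xs → R (suc d) x → R d x)
  stabilises = search (length xs) 0 (ℕ.m≤m+n _ _)
    where
    count : ℕ → ℕ
    count d = length (filter (R? d) xs)

    search : ∀ k d → length xs ≤ k + count d → ∃[ d ] (∀ {x} → x ∈ xs → R (suc d) x → R d x)
    search k d bound with Any.any? (λ x → R? (suc d) x ×-dec ¬? (R? d x)) xs
    ... | no ¬new = d , λ {x} x∈ r → decidable-stable (R? d x) λ ¬r → ¬new (lose x∈ (r , ¬r))
    search k d bound | yes new with find new
    ... | x , x∈ , r , ¬r with k | length-filter-mono-< (R? d) (R? (suc d)) (R-grows d) x∈ r ¬r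
    ...   | zero  | more = contradiction (ℕ.≤-<-trans bound more) (ℕ.≤⇒≯ (length-filter (R? (suc d)) xs))
    ...   | suc k | more = search k (suc d)
      (ℕ.≤-trans bound (ℕ.≤-trans (ℕ.≤-reflexive (sym (ℕ.+-suc k (count d)))) (ℕ.+-monoʳ-≤ k more)))

module _ {n} {U : Graph n} (s : ℕ → Fin n) (s-step : ∀ i → Edge U (s i) (s (suc i)))
         (nonbacktracking : ∀ i → s (2 + i) ≢ s i) where

  private
    -- Induction on the gap `g`. A repetition strictly inside the gap is a shorter return; without
    -- one the stretch has distinct vertices. Gap 1 would be a loop, gap 2 a backtracking.
    return⇒cycle : ∀ fuel g i → g ≤ fuel → 0 < g → s (i + g) ≡ s i → Cycle U
    return⇒cycle zero _ _ z≤n () _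
    return⇒cycle (suc fuel) g i g≤ 0<g back
      with any? (λ (a : Fin g) → any? λ (b : Fin g) →
             toℕ a ℕ.<? toℕ b ×-dec s (i + toℕ b) Fin.≟ s (i + toℕ a))
    ... | yes (a , b , a<b , back′) =
      return⇒cycle fuel (toℕ b ℕ.∸ toℕ a) (i + toℕ a)
        (ℕ.≤-pred (ℕ.≤-trans (s≤s (ℕ.m∸n≤m (toℕ b) (toℕ a))) (ℕ.≤-trans (Fin.toℕ<n b) g≤)))
        (ℕ.m<n⇒0<n∸m a<b)
        (trans (cong s (trans (ℕ.+-assoc i _ _) (cong (i +_) (ℕ.m+[n∸m]≡n (ℕ.<⇒≤ a<b))))) back′)
    return⇒cycle (suc fuel) 1 i _ _ back | no _ = contradiction
      (subst (Edge U (s i)) (trans (cong s (ℕ.+-comm 1 i)) back) (s-step i)) (edge-irreflexive U refl)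
    return⇒cycle (suc fuel) 2 i _ _ back | no _ = contradiction
      (trans (cong s (ℕ.+-comm 2 i)) back) (nonbacktracking i)
    return⇒cycle (suc fuel) (suc (suc (suc k))) i _ _ back | no ¬repeat = record
      { vertex   = vertex
      ; distinct = distinct
      ; step     = λ j → subst₂ (Edge U)
          (cong (λ m → s (i + m)) (sym (Fin.toℕ-inject₁ j))) (cong s (sym (ℕ.+-suc i (toℕ j))))
          (s-step (i + toℕ j))
      ; close    = subst₂ (Edge U)
          (cong (λ m → s (i + m)) (sym (Fin.toℕ-fromℕ (2 + k))))
          (trans (cong s (sym (ℕ.+-suc i (2 + k)))) (trans back (cong s (sym (ℕ.+-identityʳ i)))))
          (s-step (i + (2 + k)))
      }
      where
      vertex : Fin (3 + k) → Fin n
      vertex j = s (i + toℕ j)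

      distinct : Injective _≡_ _≡_ vertex
      distinct {a} {b} eq with ℕ.<-cmp (toℕ a) (toℕ b)
      ... | tri< a<b _ _ = contradiction (a , b , a<b , sym eq) ¬repeat
      ... | tri≈ _ a≡b _ = Fin.toℕ-injective a≡b
      ... | tri> _ _ b<a = contradiction (b , a , b<a , eq) ¬repeat

  nonbacktracking⇒cycle : Cycle U
  nonbacktracking⇒cycle with pigeonhole (ℕ.n<1+n n) (s ∘ toℕ)
  ... | a , b , a<b , eq = return⇒cycle (toℕ b ℕ.∸ toℕ a) _ (toℕ a) ℕ.≤-refl (ℕ.m<n⇒0<n∸m a<b)
    (trans (cong s (ℕ.m+[n∸m]≡n (ℕ.<⇒≤ a<b))) (sym eq))

-- The dual of a tree

-- Every finite set of vertices of an acyclic graph contains a vertex with at most one neighbour in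
-- the set: otherwise one could walk inside the set for ever without backtracking.
module _ {n} (U : Graph n) (acyclic : ¬ Cycle U) where

  private
    Edge? : Decidable (Edge U)
    Edge? u v = T? (edge U u v)

    Branching : List (Fin n) → Pred (Fin n) 0ℓ
    Branching W w = ∃[ a ] ∃[ b ] (a ∈ W × Edge U w a) × (b ∈ W × Edge U w b) × a ≢ b

    branching? : ∀ W w → Dec (Branching W w)
    branching? W w = map′ collect
      (λ { (a , b , (a∈ , wa) , (b∈ , wb) , a≢b) → lose a∈ (lose b∈ (wa , wb , a≢b)) })
      (Any.any? (λ a → Any.any? (λ b → Edge? w a ×-dec Edge? w b ×-dec ¬? (a Fin.≟ b)) W) W)
      where
      collect : Any (λ a → Any (λ b → Edge U w a × Edge U w b × a ≢ b) W) W → Branching W w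
      collect any with find any
      ... | a , a∈ , any′ with find any′
      ...   | b , b∈ , wa , wb , a≢b = a , b , (a∈ , wa) , (b∈ , wb) , a≢b

    module _ (W : List (Fin n)) (branch : ∀ {w} → w ∈ W → Branching W w) where

      State : Set
      State = Fin n × ∃[ w ] w ∈ W

      current : State → Fin n
      current = proj₁ ∘ proj₂

      advance : ((previous , w , w∈) : State) → ∃[ x ] x ∈ W × Edge U w x × x ≢ previous
      advance (previous , w , w∈) with branch w∈
      ... | a , b , (a∈ , wa) , (b∈ , wb) , a≢b with a Fin.≟ previous
      ...   | yes refl = b , b∈ , wb , a≢b ∘ sym
      ...   | no a≢p   = a , a∈ , wa , a≢p

      next : State → State
      next σ = current σ , proj₁ (advance σ) , proj₁ (proj₂ (advance σ))

      iterate : State → ℕ → State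
      iterate σ zero    = σ
      iterate σ (suc i) = next (iterate σ i)

      all-branching⇒cycle : ∀ {w} → w ∈ W → Cycle U
      all-branching⇒cycle {w} w∈ = nonbacktracking⇒cycle
        (current ∘ σ)
        (λ i → proj₁ (proj₂ (proj₂ (advance (σ i)))))
        (λ i → proj₂ (proj₂ (proj₂ (advance (σ (suc i))))))
        -- The first `previous` is a dummy: non-backtracking at `i` concerns the advance from stage
        -- `suc i`, where it is the true predecessor.
        where σ = iterate (w , w , w∈)

  leaf : ∀ W {w} → w ∈ W →
         ∃[ v ] v ∈ W × (∀ {a b} → a ∈ W → Edge U v a → b ∈ W → Edge U v b → a ≡ b)
  leaf W w∈ with Any.any? (λ v → ¬? (branching? W v)) W
  ... | yes some = let v , v∈ , ¬branching = find some
                   in v , v∈ , λ {a} {b} a∈ va b∈ vb →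
                        decidable-stable (a Fin.≟ b) λ a≢b → ¬branching (a , b , (a∈ , va) , (b∈ , vb) , a≢b)
  ... | no none  = contradiction
    (all-branching⇒cycle W (λ {v} v∈ → decidable-stable (branching? W v) λ ¬b → none (lose v∈ ¬b)) w∈)
    acyclic

module _ {n} {A : Set} (w : Fin n) (y : A) (φ : Fin n → A) where

  override : Fin n → A
  override u with u Fin.≟ w
  ... | yes _ = y
  ... | no  _ = φ u

  override-∀ : (C : Fin n → A → Set) → C w y → (∀ u → u ≢ w → C u (φ u)) → ∀ u → C u (override u)
  override-∀ C at-w elsewhere u with u Fin.≟ w
  ... | yes refl = at-w
  ... | no  u≢w  = elsewhere u u≢w

module Dual (T : Digraph) (U : Graph (order T)) (tree : IsUndirectedTree U)
            (orientation : IsOrientationOf T U) where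

  open IsUndirectedTree tree
  open IsOrientationOf orientation

  arc⇒edge : ∀ {u v} → Arc T u v → Edge U u v
  arc⇒edge a = from (underlying _ _) (inj₁ a)

  Prohibited : Rel (Fin (order T) → Fin (order T)) 0ℓ
  Prohibited f g = ∃[ u ] ∃[ v ] Arc T u v × f u ≡ v × g v ≡ u

  prohibited? : Decidable Prohibited
  prohibited? f g = any? λ u → any? λ v → T? (arc T u v) ×-dec f u Fin.≟ v ×-dec g v Fin.≟ u

  Choice : Pred (Fin (order T) → Fin (order T)) 0ℓ
  Choice f = ∀ u → Edge U u (f u)

  choice? : ∀ f → Dec (Choice f)
  choice? f = all? λ u → T? (edge U u (f u))

  module Choices = Filtered {order T ^ order T} (choice? ∘ finToFun)

  decode : Fin Choices.size → Fin (order T) → Fin (order T)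
  decode = finToFun ∘ Choices.member

  -- The bear construction of Nešetřil and Tardif: vertices choose a neighbour of each vertex of T.
  module D = CodeDigraph Choices.size decode (λ f g → ¬? (prohibited? f g))

  dual : Digraph
  dual = D.digraph

  -- A homomorphism makes each `u` choose a neighbour `p u`. If `p (p u)` were `u`, the two choices
  -- would be prohibited along the arc between them; so following `p` never backtracks, which
  -- acyclicity excludes.
  ↮dual : T ↮ dual
  ↮dual φ = acyclic (nonbacktracking⇒cycle walk step nonbacktracking)
    where
    p : Fin (order T) → Fin (order T)
    p u = decode (fun φ u) u

    p-edge : ∀ u → Edge U u (p u)
    p-edge u = Choices.member-satisfies (fun φ u) u

    walk : ℕ → Fin (order T)
    walk zero    = nonempty
    walk (suc i) = p (walk i)

    step : ∀ i → Edge U (walk i) (walk (suc i))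
    step i = p-edge (walk i)

    no-return : ∀ u → p (p u) ≢ u
    no-return u back with to (underlying _ _) (p-edge u)
    ... | inj₁ a = D.arc⁻ _ _ (preserves φ a) (_ , _ , a , refl , back)
    ... | inj₂ a = D.arc⁻ _ _ (preserves φ a) (_ , _ , a , back , refl)

    nonbacktracking : ∀ i → walk (2 + i) ≢ walk i
    nonbacktracking i = no-return (walk i)

  module _ (G : Digraph) where

    Compatible : (u v : Fin (order T)) → Rel (Vertex G) 0ℓ
    Compatible u v x y = (Arc T u v → Arc G x y) × (Arc T v u → Arc G y x)

    compatible? : ∀ u v → Decidable (Compatible u v)
    compatible? u v x y = (T? (arc T u v) →-dec T? (arc G x y)) ×-dec (T? (arc T v u) →-dec T? (arc G y x))

    -- Arc consistency: by stage d, x has been ruled out as an image of u.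
    Removed : ℕ → Fin (order T) → Pred (Vertex G) 0ℓ
    Removed zero    u x = ⊥
    Removed (suc d) u x = ∃[ v ] Edge U u v × (∀ y → Compatible u v x y → Removed d v y)

    removed? : ∀ d u → Unary.Decidable (Removed d u)
    removed? zero    u x = no λ ()
    removed? (suc d) u x = any? λ v → T? (edge U u v) ×-dec
      all? λ y → compatible? u v x y →-dec removed? d v y

    removed-suc : ∀ d {u x} → Removed d u x → Removed (suc d) u x
    removed-suc (suc d) (v , uv , r) = v , uv , λ y c → removed-suc d (r y c)

    removed-mono : ∀ {d e u x} → d ℕ.≤′ e → Removed d u x → Removed e u x
    removed-mono ℕ.≤′-refl     r = r
    removed-mono (ℕ.≤′-step d≤e) r = removed-suc _ (removed-mono d≤e r)

    private
      pairs : List (Fin (order T) × Vertex G)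
      pairs = cartesianProduct (allFin _) (allFin _)

      stable : ∃[ d ] (∀ {ux} → ux ∈ pairs →
                        Removed (suc d) (proj₁ ux) (proj₂ ux) → Removed d (proj₁ ux) (proj₂ ux))
      stable = stabilises (λ d (u , x) → removed? d u x) (λ d → removed-suc d) pairs

    final : ℕ
    final = proj₁ stable

    Alive : Fin (order T) → Pred (Vertex G) 0ℓ
    Alive u x = ¬ Removed final u x

    -- If every compatible value at `v` were removed by the stage `final`, `x` would be removed one
    -- stage later, hence by stability already at `final`.
    alive-neighbour : ∀ {u v x} → Edge U u v → Alive u x → ∃[ y ] Compatible u v x y × Alive v y
    alive-neighbour {u} {v} {x} uv alive
      with any? (λ y → compatible? u v x y ×-dec ¬? (removed? final v y))
    ... | yes found = found
    ... | no  none  = contradiction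
      (proj₂ stable (∈-cartesianProduct⁺ (∈-allFin u) (∈-allFin x))
        (v , uv , λ y c → decidable-stable (removed? final v y) λ a → none (y , c , a)))
      alive

    module _ {u₀ x₀} (alive₀ : Alive u₀ x₀) where

      alive-at : ∀ u → ∃[ x ] Alive u x
      alive-at u = along (connected u₀ u) (x₀ , alive₀)
        where
        along : ∀ {v w} → Star (Edge U) v w → ∃[ x ] Alive v x → ∃[ x ] Alive w x
        along ε         alive       = alive
        along (e ◅ es) (_ , alive) = let y , _ , alive′ = alive-neighbour e alive in along es (y , alive′)

      _≢?_ : (u w : Fin (order T)) → Dec (u ≢ w)
      u ≢? w = ¬? (u Fin.≟ w)

      PartialHom : List (Fin (order T)) → Set
      PartialHom W = Σ[ φ ∈ (Fin (order T) → Vertex G) ]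
        (∀ u → Alive u (φ u)) × (∀ {u v} → u ∈ W → v ∈ W → Arc T u v → Arc G (φ u) (φ v))

      -- The leaf `w` has at most one neighbour in `W`, so its new value has at most one constraint
      -- to meet, and an alive value meeting it exists.
      extend : ∀ {W w} → w ∈ W →
               (∀ {a b} → a ∈ W → Edge U w a → b ∈ W → Edge U w b → a ≡ b) →
               PartialHom (filter (_≢? w) W) → PartialHom W
      extend {W} {w} w∈ leaf-w (φ , φ-alive , φ-hom) = φ′ , φ′-alive , φ′-hom
        where
        Fits : Vertex G → Set
        Fits y = ∀ {a} → a ∈ W → Edge U w a → Compatible a w (φ a) y

        image : ∃[ y ] Alive w y × Fits y
        image with Any.any? (λ a → T? (edge U w a)) W
        ... | no  none = let y , alive = alive-at w in y , alive , λ a∈ wa → contradiction (lose a∈ wa) none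
        ... | yes some =
          let a , a∈ , wa    = find some
              y , c , alive = alive-neighbour (edge-symmetric U wa) (φ-alive a)
          in y , alive , λ b∈ wb → subst (λ b → Compatible b w (φ b) y) (leaf-w a∈ wa b∈ wb) c

        y = proj₁ image
        fits = proj₂ (proj₂ image)

        φ′ = override w y φ

        φ′-alive : ∀ u → Alive u (φ′ u)
        φ′-alive = override-∀ w y φ Alive (proj₁ (proj₂ image)) (λ u _ → φ-alive u)

        φ′-hom : ∀ {u v} → u ∈ W → v ∈ W → Arc T u v → Arc G (φ′ u) (φ′ v)
        -- The cases are first on `u` being `w`, then on `v`; both at once would make a loop at `w`.
        φ′-hom {u} {v} = override-∀ w y φ (λ u z → u ∈ W → v ∈ W → Arc T u v → Arc G z (φ′ v))
          (override-∀ w y φ (λ v z → w ∈ W → v ∈ W → Arc T w v → Arc G y z)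
            (λ _ _ a → contradiction a (λ a → edge-irreflexive U refl (arc⇒edge a)))
            (λ v _ _ v∈ a → proj₂ (fits v∈ (arc⇒edge a)) a) v)
          (λ u u≢w → override-∀ w y φ (λ v z → u ∈ W → v ∈ W → Arc T u v → Arc G (φ u) z)
            (λ u∈ _ a → proj₁ (fits u∈ (edge-symmetric U (arc⇒edge a))) a)
            (λ v v≢w u∈ v∈ → φ-hom (∈-filter⁺ (_≢? w) u∈ u≢w) (∈-filter⁺ (_≢? w) v∈ v≢w)) v)
          u

      partialHom : ∀ k W → length W ≤ k → PartialHom W
      partialHom _       []        _ = proj₁ ∘ alive-at , proj₂ ∘ alive-at , λ ()
      partialHom (suc k) W@(_ ∷ _) W≤ =
        let w , w∈ , leaf-w = leaf U acyclic W (here refl)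
        in extend w∈ leaf-w (partialHom k _
             (ℕ.≤-pred (ℕ.<-≤-trans (filter-notAll (_≢? w) W (lose w∈ λ w≢w → w≢w refl)) W≤)))

      alive⇒hom : T ⟶ G
      alive⇒hom = let φ , _ , φ-hom = partialHom _ (allFin _) ℕ.≤-refl
                  in record { fun = φ ; preserves = φ-hom (∈-allFin _) (∈-allFin _) }

    FirstRemoved : ℕ → Fin (order T) → Pred (Vertex G) 0ℓ
    FirstRemoved d u x = Removed (suc d) u x × ¬ Removed d u x

    firstRemoved : ∀ d {u x} → Removed d u x → ∃[ e ] FirstRemoved e u x
    firstRemoved (suc d) {u} {x} r with removed? d u x
    ... | yes r′ = firstRemoved d r′
    ... | no ¬r′ = d , r , ¬r′

    -- With one alive pair `T` would map to `G`, so every `x` is removed at every `u`. The vertex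
    -- `x` is sent to the choice that takes `u` to the neighbour blamed for its first removal there.
    ⟶dual : T ↮ G → G ⟶ dual
    ⟶dual T↮G = record
      { fun       = code
      ; preserves = λ {x} {y} a → D.arc⁺ (code x) (code y) λ { (u , v , uv , fu≡v , gv≡u) →
          opposed x y a uv (trans (sym (decode-code x u)) fu≡v) (trans (sym (decode-code y v)) gv≡u) }
      }
      where
      first : ∀ u x → ∃[ e ] FirstRemoved e u x
      first u x = firstRemoved final (decidable-stable (removed? final u x) (T↮G ∘ alive⇒hom))

      reason : Vertex G → Fin (order T) → Fin (order T)
      reason x u = proj₁ (proj₁ (proj₂ (first u x)))

      reason-edge : ∀ x → Choice (reason x)
      reason-edge x u = proj₁ (proj₂ (proj₁ (proj₂ (first u x))))

      decoded-choice : ∀ x → Choice (finToFun (funToFin (reason x)))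
      decoded-choice x u = subst (Edge U u) (sym (finToFun-funToFin (reason x) u)) (reason-edge x u)

      code : Vertex G → Fin Choices.size
      code x = Choices.index (funToFin (reason x)) (decoded-choice x)

      decode-code : ∀ x u → decode (code x) u ≡ reason x u
      decode-code x u = trans
        (cong (λ c → finToFun c u) (Choices.member-index (funToFin (reason x)) (decoded-choice x)))
        (finToFun-funToFin (reason x) u)

      -- If the removals of x at u and of y at v were blamed on each other, each would precede the other.
      opposed : ∀ x y → Arc G x y → ∀ {u v} → Arc T u v → reason x u ≡ v → reason y v ≢ u
      opposed x y xy {u} {v} uv reason-x reason-y with first u x | first v y
      ... | e , (v′ , _ , r) , ¬r | e′ , (u′ , _ , r′) , ¬r′ with refl ← reason-x | refl ← reason-y =
        ℕ.<-asym
          (ℕ.≰⇒> λ e′≤e → ¬r (removed-mono (ℕ.≤⇒≤′ e′≤e)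
            (r′ x ((λ vu → contradiction vu vu-absent) , λ _ → xy))))
          (ℕ.≰⇒> λ e≤e′ → ¬r′ (removed-mono (ℕ.≤⇒≤′ e≤e′)
            (r y ((λ _ → xy) , λ vu → contradiction vu vu-absent))))
        where
        vu-absent = oneDirection u v uv

  dual-duality : ∀ G → (G ⟶ dual) ⇔ (T ↮ G)
  dual-duality G = mk⇔ (λ G⟶D T⟶G → ↮dual (G⟶D ∘ₕ T⟶G)) (⟶dual G)

-- Shift graphs and unrolling

-- Drops the last entry. The arcs of the shift graph go from `front xs` to `Vec.tail xs` for
-- increasing `xs`.
front : ∀ {A : Set} {n} → Vec A (suc n) → Vec A n
front (_ ∷ [])         = []
front (x ∷ xs@(_ ∷ _)) = x ∷ front xs

lookup-front : ∀ {A : Set} {n} (xs : Vec A (suc n)) i → Vec.lookup (front xs) i ≡ Vec.lookup xs (inject₁ i)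
lookup-front (_ ∷ _ ∷ _)      zero    = refl
lookup-front (_ ∷ xs@(_ ∷ _)) (suc i) = lookup-front xs i

lookup-tail : ∀ {A : Set} {n} (xs : Vec A (suc n)) i → Vec.lookup (Vec.tail xs) i ≡ Vec.lookup xs (suc i)
lookup-tail (_ ∷ _) _ = refl

tail-front : ∀ {A : Set} {n} (xs : Vec A (2 + n)) → Vec.tail (front xs) ≡ front (Vec.tail xs)
tail-front (_ ∷ _ ∷ _) = refl

Increasing : ∀ {N n} → Pred (Vec (Fin N) n) 0ℓ
Increasing = AllPairs Fin._<_

increasing-front : ∀ {N n} {xs : Vec (Fin N) (suc n)} → Increasing xs → Increasing (front xs)
increasing-front {xs = _ ∷ []}    _        = []
increasing-front {xs = _ ∷ _ ∷ _} (p ∷ ps) = all-front p ∷ increasing-front ps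
  where
  all-front : ∀ {A : Set} {P : Pred A 0ℓ} {n} {xs : Vec A (suc n)} →
              VecAll.All P xs → VecAll.All P (front xs)
  all-front {xs = _ ∷ []}    _        = []
  all-front {xs = _ ∷ _ ∷ _} (p ∷ ps) = p ∷ all-front ps

increasing-tail : ∀ {N n} {xs : Vec (Fin N) (suc n)} → Increasing xs → Increasing (Vec.tail xs)
increasing-tail (_ ∷ ps) = ps

increasing⇒injective : ∀ {N n} {xs : Vec (Fin N) n} → Increasing xs →
                       ∀ i j → Vec.lookup xs i ≡ Vec.lookup xs j → i ≡ j
increasing⇒injective = lookup-injective ∘ VecAllPairs.map Fin.<⇒≢

private
  bit : ∀ {A : Set} → Dec A → Fin 2
  bit (yes _) = zero
  bit (no _)  = suc zero

  bit-≡ : ∀ {A B : Set} (a? : Dec A) (b? : Dec B) → bit a? ≡ bit b? → A → B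
  bit-≡ _       (yes b) _  _ = b
  bit-≡ (no ¬a) (no _)  _  a = contradiction a ¬a
  bit-≡ (yes _) (no _)  () _

-- Shift graphs have unbounded chromatic number. A colouring of the (k+2)-tuples with c colours
-- yields a colouring of the (k+1)-tuples J with 2ᶜ colours: the set of the colours of i ∷ J.
shift-monochromatic : ∀ k c → ∃[ N ] ∀ (colour : Vec (Fin N) (suc k) → Fin c) →
  ∃[ xs ] Increasing xs × colour (front xs) ≡ colour (Vec.tail xs)
shift-monochromatic zero    c = suc c , λ colour →
  let i , j , i<j , eq = pigeonhole (ℕ.n<1+n c) (λ i → colour (i ∷ []))
  in i ∷ j ∷ [] , ((i<j ∷ []) ∷ [] ∷ []) , eq
shift-monochromatic (suc k) c with shift-monochromatic k (2 ^ c)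
... | N , monochromatic = N , lengthen
  where
  module _ (colour : Vec (Fin N) (2 + k) → Fin c) where

    Precedes : Vec (Fin N) (suc k) → Fin c → Set
    Precedes xs γ = ∃[ i ] i Fin.< Vec.head xs × colour (i ∷ xs) ≡ γ

    precedes? : ∀ xs γ → Dec (Precedes xs γ)
    precedes? xs γ = any? λ i → i Fin.<? Vec.head xs ×-dec colour (i ∷ xs) Fin.≟ γ

    colours : Vec (Fin N) (suc k) → Fin (2 ^ c)
    colours xs = funToFin (bit ∘ precedes? xs)

    lengthen : ∃[ xs ] Increasing xs × colour (front xs) ≡ colour (Vec.tail xs)
    lengthen with monochromatic colours
    -- The colour of `xs` lies in the colour set of its tail, witnessed by `x`, hence also in that
    -- of `front xs`. So some `i` below `x` gives `i ∷ front xs` the colour of `xs`, and these are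
    -- the front and the tail of `i ∷ xs`.
    ... | xs@(x ∷ y ∷ ys) , increasing@((x<y ∷ _) ∷ _) , eq
      with bit-≡ (precedes? (y ∷ ys) γ) (precedes? (front xs) γ)
             (trans (sym (finToFun-funToFin (bit ∘ precedes? (y ∷ ys)) γ))
               (trans (cong (λ m → finToFun m γ) (sym eq)) (finToFun-funToFin (bit ∘ precedes? (front xs)) γ)))
             (x , x<y , refl)
      where γ = colour xs
    ... | i , i<x , eq′ = i ∷ xs , (below increasing ∷ increasing) , eq′
      where
      below : ∀ {n} {zs : Vec (Fin N) n} → Increasing (x ∷ zs) → VecAll.All (i Fin.<_) (x ∷ zs)
      below (x<zs ∷ _) = i<x ∷ VecAll.map (λ {z} → Fin.<-trans {i = i} {j = x} {k = z} i<x) x<zs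

Over : ∀ {A : Digraph} (u v : Vertex A) → Rel (Vertex A) 0ℓ
Over u v a b = a ≡ u × b ≡ v

-- The trace on `F` of a map to the unrolling of `A`: `level` records how far the tuples have been
-- shifted.
record Lift (F A : Digraph) (u v : Vertex A) : Set where
  field
    hom   : F ⟶ A
    level : Vertex F → ℕ
    drop  : ∀ {a b} → Arc F a b → Over {A} u v (fun hom a) (fun hom b) → level a ≡ suc (level b)
    keep  : ∀ {a b} → Arc F a b → ¬ Over {A} u v (fun hom a) (fun hom b) → level a ≡ level b

walkLength : ∀ {A : Set} {R : Rel A 0ℓ} {x y} → Star R x y → ℕ
walkLength ε        = 0
walkLength (_ ◅ rs) = suc (walkLength rs)

-- Many copies of A, indexed by the tuples, in which the arc (u , v) leads from each tuple to its shifts.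
module Unrolled (A : Digraph) (u v : Vertex A) (N k : ℕ) where

  Tuple : Set
  Tuple = Vec (Fin N) (suc k)

  over? : Decidable (Over {A} u v)
  over? a b = a Fin.≟ u ×-dec b Fin.≟ v

  UnrolledArc : Rel (Tuple × Vertex A) 0ℓ
  UnrolledArc (I , a) (J , b) = Arc A a b × Increasing I × Increasing J ×
    (Over {A} u v a b × Vec.tail I ≡ front J ⊎ ¬ Over {A} u v a b × I ≡ J)

  unrolledArc? : Decidable UnrolledArc
  unrolledArc? (I , a) (J , b) = T? (arc A a b) ×-dec increasing? I ×-dec increasing? J ×-dec
    (over? a b ×-dec Vec.≡-dec Fin._≟_ (Vec.tail I) (front J) ⊎-dec
     ¬? (over? a b) ×-dec Vec.≡-dec Fin._≟_ I J)
    where increasing? = VecAllPairs.allPairs? Fin._<?_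

  decodePair : Fin (N ^ suc k) × Vertex A → Tuple × Vertex A
  decodePair (i , a) = tabulate (finToFun i) , a

  decode : Fin (N ^ suc k * order A) → Tuple × Vertex A
  decode = decodePair ∘ remQuot (order A)

  encode : Tuple → Vertex A → Fin (N ^ suc k * order A)
  encode I a = combine (funToFin (Vec.lookup I)) a

  decode-encode : ∀ I a → decode (encode I a) ≡ (I , a)
  decode-encode I a = trans
    (cong decodePair (remQuot-combine (funToFin (Vec.lookup I)) a))
    (cong (_, a) (trans (tabulate-cong (finToFun-funToFin (Vec.lookup I))) (tabulate∘lookup I)))

  open CodeDigraph (N ^ suc k * order A) decode unrolledArc? public
    renaming (digraph to unrolled)

  arc-encode : ∀ {I a J b} → UnrolledArc (I , a) (J , b) → Arc unrolled (encode I a) (encode J b)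
  arc-encode {I} {a} {J} {b} r = arc⁺ (encode I a) (encode J b)
    (subst₂ UnrolledArc (sym (decode-encode I a)) (sym (decode-encode J b)) r)

  module _ {H : Digraph} (ψ : unrolled ⟶ H) where

    colour : Tuple → Fin (order H ^ order A)
    colour I = funToFin (λ a → fun ψ (encode I a))

    -- A colour records `ψ` on a whole copy of `A`. If two copies joined by a shift have the same
    -- colour, the arc between them can be read as an arc back into the first copy, which then maps
    -- all of `A`.
    fold : (xs : Vec (Fin N) (2 + k)) → Increasing xs → colour (front xs) ≡ colour (Vec.tail xs) → A ⟶ H
    fold xs increasing eq = record { fun = λ a → fun ψ (encode (front xs) a) ; preserves = arc-preserved }
      where
      agree : ∀ a → fun ψ (encode (front xs) a) ≡ fun ψ (encode (Vec.tail xs) a)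
      agree a = trans (sym (finToFun-funToFin (λ a → fun ψ (encode (front xs) a)) a))
        (trans (cong (λ m → finToFun m a) eq) (finToFun-funToFin (λ a → fun ψ (encode (Vec.tail xs) a)) a))

      inc = increasing-front increasing

      arc-preserved : ∀ {a b} → Arc A a b → Arc H (fun ψ (encode (front xs) a)) (fun ψ (encode (front xs) b))
      arc-preserved {a} {b} ab with over? a b
      ... | yes over = subst (Arc H _) (sym (agree b)) (preserves ψ
        (arc-encode (ab , inc , increasing-tail increasing , inj₁ (over , tail-front xs))))
      ... | no ¬over = preserves ψ (arc-encode (ab , inc , inc , inj₂ (¬over , refl)))

-- In tuples longer than all the walks needed to reach the vertices of F from f₀, an entry in the
-- middle of the tuple at f₀ is never shifted out, and its position is the level.
module _ {F A : Digraph} {u v : Vertex A} {N r : ℕ} (f₀ : Vertex F)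
         (walk : ∀ f → ∃[ w ] walkLength {R = SymClosure (Arc F)} {f₀} {f} w ≤ r)
         (θ : F ⟶ Unrolled.unrolled A u v N (suc (r + r))) where

  open Unrolled A u v N (suc (r + r))

  private
    tuple : Vertex F → Tuple
    tuple f = proj₁ (decode (fun θ f))

    image : Vertex F → Vertex A
    image f = proj₂ (decode (fun θ f))

    θ-arc : ∀ {a b} → Arc F a b → UnrolledArc (tuple a , image a) (tuple b , image b)
    θ-arc {a} {b} ab = arc⁻ (fun θ a) (fun θ b) (preserves θ ab)

    middle : Fin (2 + (r + r))
    middle = Fin.fromℕ< (ℕ.m≤n⇒m≤1+n (s≤s (ℕ.m≤m+n r r)))

    z : Fin N
    z = Vec.lookup (tuple f₀) middle

    -- After `ℓ` steps the entry `z` is within distance `ℓ` of its starting place `r`, stated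
    -- without subtraction.
    Position : ℕ → Vertex F → Set
    Position ℓ f = ∃[ q ] Vec.lookup (tuple f) q ≡ z × r ≤ toℕ q + ℓ × toℕ q ≤ r + ℓ

    -- Tuples have one place beyond `r + r`, so a position within the bound is never the last one
    -- and has a successor.
    restrict : ∀ {q : Fin (2 + (r + r))} → toℕ q ≤ r + r → ∃[ p ] inject₁ p ≡ q
    restrict {q} q≤ = Fin.fromℕ< (s≤s q≤) ,
      Fin.toℕ-injective (trans (Fin.toℕ-inject₁ _) (Fin.toℕ-fromℕ< (s≤s q≤)))

    shifted : ∀ a b → Vec.tail (tuple a) ≡ front (tuple b) →
              ∀ p → Vec.lookup (tuple a) (suc p) ≡ Vec.lookup (tuple b) (inject₁ p)
    shifted a b eq p = trans (sym (lookup-tail (tuple a) p))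
      (trans (cong (λ I → Vec.lookup I p) eq) (lookup-front (tuple b) p))

    weaken : ∀ {ℓ f} → Position ℓ f → Position (suc ℓ) f
    weaken {ℓ} (q , eq , low , high) =
      q , eq , ℕ.≤-trans low (ℕ.+-monoʳ-≤ (toℕ q) (ℕ.n≤1+n ℓ)) , ℕ.≤-trans high (ℕ.+-monoʳ-≤ r (ℕ.n≤1+n ℓ))

    forward : ∀ {ℓ a b} → suc ℓ ≤ r → Arc F a b → Position ℓ a → Position (suc ℓ) b
    forward {ℓ} {a} {b} ℓ<r ab pos with θ-arc ab
    ... | _ , _ , _ , inj₂ (_ , I≡J) =
      let q , eq , bounds = weaken pos in q , trans (cong (λ I → Vec.lookup I q) (sym I≡J)) eq , bounds
    -- At position zero the shift would lose `z`, but fewer than `r` steps cannot have brought it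
    -- there.
    forward {ℓ} ℓ<r ab (zero , _ , low , _) | _ , _ , _ , inj₁ _ = contradiction low (ℕ.<⇒≱ ℓ<r)
    forward {ℓ} {a} {b} ℓ<r ab (suc p , eq , low , high) | _ , _ , _ , inj₁ (_ , eq′) =
      inject₁ p , trans (sym (shifted a b eq′ p)) eq
      , subst (λ m → r ≤ m + suc ℓ) (sym (Fin.toℕ-inject₁ p))
          (ℕ.≤-trans low (ℕ.≤-reflexive (sym (ℕ.+-suc (toℕ p) ℓ))))
      , subst (_≤ r + suc ℓ) (sym (Fin.toℕ-inject₁ p))
          (ℕ.≤-trans (ℕ.n≤1+n _) (ℕ.≤-trans high (ℕ.+-monoʳ-≤ r (ℕ.n≤1+n ℓ))))

    backward : ∀ {ℓ a b} → suc ℓ ≤ r → Arc F b a → Position ℓ a → Position (suc ℓ) b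
    backward {ℓ} {a} {b} ℓ<r ba pos with θ-arc ba
    ... | _ , _ , _ , inj₂ (_ , J≡I) =
      let q , eq , bounds = weaken pos in q , trans (cong (λ I → Vec.lookup I q) J≡I) eq , bounds
    backward {ℓ} {a} {b} ℓ<r ba (q , eq , low , high) | _ , _ , _ , inj₁ (_ , eq′)
      with restrict (ℕ.≤-trans high (ℕ.+-monoʳ-≤ r (ℕ.<⇒≤ ℓ<r)))
    ... | p , refl = suc p , trans (shifted b a eq′ p) eq
      , ℕ.≤-trans low (ℕ.≤-trans (ℕ.≤-reflexive (cong (_+ ℓ) (Fin.toℕ-inject₁ p)))
          (ℕ.+-mono-≤ (ℕ.n≤1+n (toℕ p)) (ℕ.n≤1+n ℓ)))
      , ℕ.≤-trans (s≤s (subst (_≤ r + ℓ) (Fin.toℕ-inject₁ p) high)) (ℕ.≤-reflexive (sym (ℕ.+-suc r ℓ)))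

    follow : ∀ {ℓ a b} (w : EqClosure (Arc F) a b) → walkLength w + ℓ ≤ r → Position ℓ a → Position r b
    follow {ℓ} ε       ℓ≤r (q , eq , low , high) =
      q , eq , ℕ.m≤n+m r (toℕ q) , ℕ.≤-trans high (ℕ.+-monoʳ-≤ r ℓ≤r)
    follow {ℓ} (s ◅ w) bound pos = follow w (subst (_≤ r) (sym (ℕ.+-suc (walkLength w) ℓ)) bound) (move s pos)
      where
      ℓ<r : suc ℓ ≤ r
      ℓ<r = ℕ.≤-trans (s≤s (ℕ.m≤n+m ℓ (walkLength w))) bound

      move : ∀ {a b} → SymClosure (Arc F) a b → Position ℓ a → Position (suc ℓ) b
      move (fwd ab) = forward ℓ<r ab
      move (bwd ba) = backward ℓ<r ba

    position : ∀ f → Position r f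
    position f = let w , w≤r = walk f in follow w (ℕ.≤-trans (ℕ.≤-reflexive (ℕ.+-identityʳ _)) w≤r)
      ( middle , refl
      , ℕ.≤-reflexive (sym (trans (ℕ.+-identityʳ _) toℕ-middle))
      , ℕ.≤-reflexive (trans toℕ-middle (sym (ℕ.+-identityʳ r))))
      where
      toℕ-middle : toℕ middle ≡ r
      toℕ-middle = Fin.toℕ-fromℕ< _

    at : ∀ f → Fin (2 + (r + r))
    at f = proj₁ (position f)

    at-z : ∀ f → Vec.lookup (tuple f) (at f) ≡ z
    at-z f = proj₁ (proj₂ (position f))

  lift : Lift F A u v
  lift = record
    { hom   = record { fun = image ; preserves = λ ab → proj₁ (θ-arc ab) }
    ; level = toℕ ∘ at
    ; drop  = drop
    ; keep  = keep
    }
    where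
    drop : ∀ {a b} → Arc F a b → Over {A} u v (image a) (image b) → toℕ (at a) ≡ suc (toℕ (at b))
    drop {a} {b} ab over with θ-arc ab
    ... | _ , _ , _ , inj₂ (¬over , _) = contradiction over ¬over
    ... | _ , inc , _ , inj₁ (_ , eq) with restrict (proj₂ (proj₂ (proj₂ (position b))))
    -- The entries of an increasing tuple are distinct, so `at a` and `suc p`, which both carry `z`,
    -- coincide.
    ...   | p , p≡ = trans (cong toℕ (increasing⇒injective inc (at a) (suc p)
              (trans (at-z a) (sym (trans (shifted a b eq p) (trans (cong (Vec.lookup (tuple b)) p≡) (at-z b)))))))
            (cong suc (trans (sym (Fin.toℕ-inject₁ p)) (cong toℕ p≡)))

    keep : ∀ {a b} → Arc F a b → ¬ Over {A} u v (image a) (image b) → toℕ (at a) ≡ toℕ (at b)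
    keep {a} {b} ab ¬over with θ-arc ab
    ... | _ , _ , _ , inj₁ (over , _) = contradiction over ¬over
    ... | _ , inc , _ , inj₂ (_ , I≡J) = cong toℕ (increasing⇒injective inc (at a) (at b)
      (trans (at-z a) (sym (trans (cong (λ I → Vec.lookup I (at b)) I≡J) (at-z b)))))

Connected : Pred Digraph 0ℓ
Connected F = ∀ a b → EqClosure (Arc F) a b

module _ {A : Set} {P : ℕ → Pred A 0ℓ} (P-mono : ∀ {m n x} → m ≤ n → P m x → P n x) where

  uniform-bound : ∀ xs → (∀ {x} → x ∈ xs → ∃[ m ] P m x) → ∃[ m ] (∀ {x} → x ∈ xs → P m x)
  uniform-bound []       _     = 0 , λ ()
  uniform-bound (x ∷ xs) bound =
    let m , p = bound (here refl) ; n , ps = uniform-bound xs (bound ∘ there)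
    in m ℕ.⊔ n , λ
      { (here refl) → P-mono (ℕ.m≤m⊔n m n) p
      ; (there x∈)  → P-mono (ℕ.m≤n⊔m m n) (ps x∈)
      }

Radius : ℕ → Pred Digraph 0ℓ
Radius r F = ∀ a b → ∃[ w ] walkLength {R = SymClosure (Arc F)} {x = a} {y = b} w ≤ r

-- Obstructions of a finite duality

-- The empty digraph maps to everything.
inhabitant : ∀ {F H} → F ↮ H → Vertex F
inhabitant {F} F↮H with any? {n = order F} (λ _ → yes tt)
... | yes (v , _) = v
... | no  empty   = contradiction
  (record { fun       = λ v → contradiction (v , tt) empty
          ; preserves = λ {v} _ → contradiction (v , tt) empty }) F↮H

connected⇒radius : ∀ {F} → Connected F → ∃[ r ] Radius r F
connected⇒radius {F} connected =
  let r , bounded = uniform-bound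
        {P = λ r (a , b) → ∃[ w ] walkLength {R = SymClosure (Arc F)} {a} {b} w ≤ r}
        (λ { m≤n (w , w≤) → w , ℕ.≤-trans w≤ m≤n })
        (cartesianProduct (allFin _) (allFin _)) (λ {(a , b)} _ → _ , connected a b , ℕ.≤-refl)
  in r , λ a b → bounded (∈-cartesianProduct⁺ (∈-allFin a) (∈-allFin b))

lift-exists : ∀ {Fs H} → IsCompleteSetOfObstructions (_∈ Fs) H → ∀ {r} → (∀ {F} → F ∈ Fs → Radius r F) →
              ∀ {A} → A ↮ H → ∀ u v → ∃[ F ] F ∈ Fs × Lift F A u v
lift-exists {H = H} complete {r} radius {A} A↮H u v =
  -- The colours are the maps of vertices from `A` to `H`, and the tuples are long enough for walks
  -- of length `r` in either direction.
  let N , monochromatic = shift-monochromatic (suc (r + r)) (order H ^ order A)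
      open Unrolled A u v N (suc (r + r))
      unrolled↮H = λ (ψ : unrolled ⟶ H) → let xs , increasing , eq = monochromatic (colour ψ)
                                          in A↮H (fold ψ xs increasing eq)
      F , F∈ , θ = obstruction complete unrolled↮H
      f₀ = inhabitant (obstruction-↮ complete F∈)
  in F , F∈ , lift f₀ (radius F∈ f₀) θ

module _ (G : Digraph) where

  private
    ArcTriple : Set
    ArcTriple = ∃[ p ] Arc G (proj₁ p) (proj₂ p)

    ifArc : ∀ p → Dec (Arc G (proj₁ p) (proj₂ p)) → List ArcTriple
    ifArc p (yes a) = (p , a) ∷ []
    ifArc p (no _)  = []

    ∈-ifArc : ∀ {p} d a → (p , a) ∈ ifArc p d
    ∈-ifArc (yes a′) a = here (cong (_ ,_) (T-irrelevant a a′))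
    ∈-ifArc (no ¬a)  a = contradiction a ¬a

    arcs : List ArcTriple
    arcs = concatMap (λ p → ifArc p (T? (arc G (proj₁ p) (proj₂ p)))) (cartesianProduct (allFin _) (allFin _))

    arcs-complete : ∀ {u v} (a : Arc G u v) → ((u , v) , a) ∈ arcs
    arcs-complete {u} {v} a = ∈-concatMap⁺ _
      (lose (∈-cartesianProduct⁺ (∈-allFin u) (∈-allFin v)) (∈-ifArc (T? (arc G u v)) a))

  joined? : Decidable (EqClosure (Arc G))
  joined? = eqClosure? Fin._≟_ (Arc G) arcs arcs-complete

-- Connected cores and their endomorphisms

module Induced (F : Digraph) {P : Pred (Vertex F) 0ℓ} (P? : Unary.Decidable P) where

  open Filtered P? public
  open CodeDigraph size member (λ u v → T? (arc F u v)) public renaming (digraph to induced)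

  inclusion : induced ⟶ F
  inclusion = record { fun = member ; preserves = λ {i} {j} → arc⁻ i j }

  arc-index : ∀ {u v} → Arc F u v → ∀ p q → Arc induced (index u p) (index v q)
  arc-index {u} {v} a p q = arc⁺ (index u p) (index v q)
    (subst₂ (Arc F) (sym (member-index u p)) (sym (member-index v q)) a)

-- For finite digraphs, these are the cores.
Rigid : Pred Digraph 0ℓ
Rigid F = (ρ : F ⟶ F) → ∀ c → ∃[ a ] fun ρ a ≡ c

module _ (F H : Digraph) (a : Vertex F) where

  private
    module X = Induced F (joined? F a)
    module Y = Induced F (λ v → ¬? (joined? F a v))

  componentwise : X.induced ⟶ H → Y.induced ⟶ H → F ⟶ H
  componentwise f g = record
    { fun       = λ v → glue v (joined? F a v)
    ; preserves = λ {u} {v} → respects (joined? F a u) (joined? F a v)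
    }
    where
    glue : ∀ v → Dec (EqClosure (Arc F) a v) → Vertex H
    glue v (yes p) = fun f (X.index v p)
    glue v (no ¬p) = fun g (Y.index v ¬p)

    respects : ∀ {u v} d e → Arc F u v → Arc H (glue u d) (glue v e)
    respects (yes p) (yes q) uv = preserves f (X.arc-index uv p q)
    respects (no ¬p) (no ¬q) uv = preserves g (Y.arc-index uv ¬p ¬q)
    respects (yes p) (no ¬q) uv = contradiction (p ◅◅ fwd uv ◅ ε) ¬q
    respects (no ¬p) (yes q) uv = contradiction (q ◅◅ bwd uv ◅ ε) ¬p

-- Induction on the number of vertices. If `F` is disconnected, a component or its complement does
-- not map to `H`; if `F` maps to itself minus a vertex, that smaller digraph does not either. When
-- neither happens, `F` is a connected core.
connectedCore : ∀ {H} k F → order F ≤ k → F ↮ H → ∃[ C ] C ⟶ F × C ↮ H × Connected C × Rigid C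
connectedCore zero    F F≤ F↮H with order F | inhabitant F↮H
connectedCore zero    F () F↮H | suc _ | _
connectedCore {H} (suc k) F F≤ F↮H
  with any? (λ a → any? λ b → ¬? (joined? F a b))
     | any? (λ c → hom? F (Induced.induced F λ v → ¬? (v Fin.≟ c)))
... | yes (a , b , ¬ab) | _ = pick (hom? X.induced H) (hom? Y.induced H)
  where
  module X = Induced F (joined? F a)
  module Y = Induced F (λ v → ¬? (joined? F a v))

  pick : Dec (X.induced ⟶ H) → Dec (Y.induced ⟶ H) → ∃[ C ] C ⟶ F × C ↮ H × Connected C × Rigid C
  pick (no X↮H) _ =
    let C , C⟶X , rest = connectedCore k X.induced (ℕ.≤-pred (ℕ.<-≤-trans (X.size< ¬ab) F≤)) X↮H
    in C , X.inclusion ∘ₕ C⟶X , rest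
  pick (yes _) (no Y↮H) =
    let C , C⟶Y , rest = connectedCore k Y.induced (ℕ.≤-pred (ℕ.<-≤-trans (Y.size< (λ ¬aa → ¬aa ε)) F≤)) Y↮H
    in C , Y.inclusion ∘ₕ C⟶Y , rest
  pick (yes f) (yes g) = contradiction (componentwise F H a f g) F↮H
... | no _ | yes (c , F⟶X) =
  let C , C⟶X , rest = connectedCore k X.induced
        (ℕ.≤-pred (ℕ.<-≤-trans (X.size< (λ c≢c → c≢c refl)) F≤)) (λ X⟶H → F↮H (X⟶H ∘ₕ F⟶X))
  in C , X.inclusion ∘ₕ C⟶X , rest
  where module X = Induced F (λ v → ¬? (v Fin.≟ c))
... | no none | no irretractable = F , idₕ , F↮H
  , (λ a b → decidable-stable (joined? F a b) λ ¬ab → none (a , b , ¬ab))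
  , λ ρ c → decidable-stable (any? λ a → fun ρ a Fin.≟ c) λ missed →
      let module X = Induced F (λ v → ¬? (v Fin.≟ c))
          avoids = λ a (eq : fun ρ a ≡ c) → missed (a , eq)
      in irretractable (c , record
           { fun       = λ a → X.index (fun ρ a) (avoids a)
           ; preserves = λ {a} {b} ab → X.arc-index (preserves ρ ab) (avoids a) (avoids b) })

module _ {A : Digraph} (ρ : A ⟶ A) (ρ-surjective : ∀ c → ∃[ a ] fun ρ a ≡ c) where

  private
    power : ℕ → A ⟶ A
    power zero    = idₕ
    power (suc i) = ρ ∘ₕ power i

    power-+ : ∀ m i a → fun (power (m + i)) a ≡ fun (power m) (fun (power i) a)
    power-+ zero    i a = refl
    power-+ (suc m) i a = cong (fun ρ) (power-+ m i a)

    power-surjective : ∀ i c → ∃[ a ] fun (power i) a ≡ c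
    power-surjective zero    c = c , refl
    power-surjective (suc i) c =
      let b , ρb≡c = ρ-surjective c ; a , eq = power-surjective i b
      in a , trans (cong (fun ρ) eq) ρb≡c

    code : ∀ {m} → Fin m → Fin (order A ^ order A)
    code i = funToFin (fun (power (toℕ i)))

    -- Since the power `i` is surjective, it cancels from the equality of the powers `i` and `j`:
    -- the power `j ∸ i` is the identity, and the power one lower is a section of `ρ`.
    section-from : ∀ i j → i < j → (∀ a → fun (power i) a ≡ fun (power j) a) →
                   Σ[ σ ∈ A ⟶ A ] (∀ a → fun ρ (fun σ a) ≡ a)
    section-from i j i<j same = power m , λ c →
      let a , eq = power-surjective i c in begin
        fun (power (suc m)) c                     ≡⟨ cong (fun (power (suc m))) eq ⟨
        fun (power (suc m)) (fun (power i) a)     ≡⟨ power-+ (suc m) i a ⟨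
        fun (power (suc m + i)) a                 ≡⟨ cong (λ l → fun (power l) a) m+i≡j ⟩
        fun (power j) a                           ≡⟨ same a ⟨
        fun (power i) a                           ≡⟨ eq ⟩
        c                                         ∎
      where
      open ≡-Reasoning
      m = j ℕ.∸ suc i
      m+i≡j : suc m + i ≡ j
      m+i≡j = trans (sym (ℕ.+-suc m i)) (ℕ.m∸n+n≡m i<j)

  surjective-endo-section : Σ[ σ ∈ A ⟶ A ] (∀ a → fun ρ (fun σ a) ≡ a)
  surjective-endo-section with pigeonhole (ℕ.n<1+n _) code
  ... | i , j , i<j , eq = section-from (toℕ i) (toℕ j) i<j λ a →
    trans (sym (finToFun-funToFin (fun (power (toℕ i))) a))
      (trans (cong (λ m → finToFun m a) eq) (finToFun-funToFin (fun (power (toℕ j))) a))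

-- Bypassed arcs and bridges

module WithoutArc (F : Digraph) (u v : Vertex F) =
  CodeDigraph {R = λ a b → Arc F a b × ¬ Over {F} u v a b} (order F) id
    (λ a b → T? (arc F a b) ×-dec ¬? (a Fin.≟ u ×-dec b Fin.≟ v))

-- An arc that is not a bridge. The bypass ignores directions and may be empty, so loops and pairs
-- of opposite arcs are covered too.
Bypassed : (F : Digraph) → Rel (Vertex F) 0ℓ
Bypassed F u v = Arc F u v × EqClosure (Arc (WithoutArc.digraph F u v)) u v

bypassed? : ∀ F → Decidable (Bypassed F)
bypassed? F u v = T? (arc F u v) ×-dec joined? (WithoutArc.digraph F u v) u v

-- Composed with a section of A ⟶ F ⟶ A, the level function becomes one on A itself. It is then
-- constant along the bypass, yet drops along the arc (u , v).
bypassed⇒↮ : ∀ {F A} → Rigid A → ∀ {u v} → Bypassed A u v → Lift F A u v → A ↮ F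
bypassed⇒↮ {F} {A} rigid {u} {v} (uv , bypass) ℒ ψ =
  ℕ.1+n≢n (trans (sym (drop (preserves σ′ uv) (fixed u , fixed v))) constant)
  where
  open Lift ℒ

  sect = surjective-endo-section (hom ∘ₕ ψ) (rigid (hom ∘ₕ ψ))

  σ′ : A ⟶ F
  σ′ = ψ ∘ₕ proj₁ sect

  fixed : ∀ a → fun hom (fun σ′ a) ≡ a
  fixed = proj₂ sect

  module W = WithoutArc A u v

  constant : level (fun σ′ u) ≡ level (fun σ′ v)
  constant = Eq.gfold isEquivalence (level ∘ fun σ′)
    (λ {a} {b} w → let ab , ¬over = W.arc⁻ a b w
                   in keep (preserves σ′ ab) λ (a≡ , b≡) →
                     ¬over (trans (sym (fixed a)) a≡ , trans (sym (fixed b)) b≡))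
    bypass

steps⇒star : ∀ {A : Set} {R : Rel A 0ℓ} m (x : Fin (suc m) → A) →
             (∀ i → R (x (inject₁ i)) (x (suc i))) → Star R (x zero) (x (fromℕ m))
steps⇒star zero    x step = ε
steps⇒star (suc m) x step = step zero ◅ steps⇒star m (x ∘ suc) (step ∘ suc)

module _ (F : Digraph) (root : Vertex F) (F-connected : Connected F)
         (bridges : ∀ u v → ¬ Bypassed F u v) where

  private
    loopless : ∀ {u v} → Arc F u v → u ≢ v
    loopless uv refl = bridges _ _ (uv , ε)

    underlyingGraph : Graph (order F)
    underlyingGraph = record
      { edge             = λ u v → arc F u v ∨ arc F v u
      ; edge-symmetric   = λ {u} {v} e → from T-∨ (Sum.swap (to (T-∨ {arc F u v} {arc F v u}) e))
      ; edge-irreflexive = λ { {u} refl e →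
          [ (λ a → loopless a refl) , (λ a → loopless a refl) ]′ (to (T-∨ {arc F u u}) e) }
      }

    edge⁻ : ∀ u v → Edge underlyingGraph u v → Arc F u v ⊎ Arc F v u
    edge⁻ u v = to (T-∨ {arc F u v} {arc F v u})

    edge⁺ : ∀ u v → Arc F u v ⊎ Arc F v u → Edge underlyingGraph u v
    edge⁺ u v = from (T-∨ {arc F u v} {arc F v u})

    star : ∀ {u v} → EqClosure (Arc F) u v → Star (Edge underlyingGraph) u v
    star = Star.map λ { (fwd a) → edge⁺ _ _ (inj₁ a) ; (bwd a) → edge⁺ _ _ (inj₂ a) }

    module _ (cycle : Cycle underlyingGraph) where
      open Cycle cycle

      first = vertex zero
      last  = vertex (fromℕ (2 + k))

      Avoids : (u v : Vertex F) → Set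
      Avoids u v = ∀ i → ¬ Over {F} u v (vertex (inject₁ i)) (vertex (suc i)) ×
                         ¬ Over {F} u v (vertex (suc i)) (vertex (inject₁ i))

      -- A cycle has at least three vertices, so no single step joins its two ends, and the way
      -- round avoids the closing edge.
      not-closing : ∀ {i : Fin (2 + k)} → vertex (suc i) ≡ last → vertex (inject₁ i) ≢ first
      not-closing {zero}  p q = contradiction (distinct p) λ ()
      not-closing {suc _} p q = contradiction (distinct q) λ ()

      first≢ : ∀ {i : Fin (2 + k)} → vertex (suc i) ≢ first
      first≢ p = contradiction (distinct p) λ ()

      around : ∀ {u v} → Avoids u v → EqClosure (Arc (WithoutArc.digraph F u v)) first last
      around {u} {v} avoids = steps⇒star (2 + k) vertex λ i → go i (edge⁻ _ _ (step i))
        where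
        module W = WithoutArc F u v
        go : ∀ i → Arc F (vertex (inject₁ i)) (vertex (suc i)) ⊎ Arc F (vertex (suc i)) (vertex (inject₁ i)) →
             SymClosure (Arc W.digraph) (vertex (inject₁ i)) (vertex (suc i))
        go i (inj₁ a) = fwd (W.arc⁺ _ _ (a , proj₁ (avoids i)))
        go i (inj₂ a) = bwd (W.arc⁺ _ _ (a , proj₂ (avoids i)))

      no-cycle : ⊥
      no-cycle with edge⁻ last first close
      ... | inj₁ a = bridges last first (a , Eq.symmetric _ (around λ i →
              (λ (p , q) → first≢ q) , λ (p , q) → not-closing p q))
      ... | inj₂ a = bridges first last (a , around λ i →
              (λ (p , q) → not-closing q p) , λ (p , q) → first≢ p)

    one-direction : ∀ u v → Arc F u v → ¬ Arc F v u
    one-direction u v uv vu = bridges u v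
      (uv , bwd (WithoutArc.arc⁺ F u v v u (vu , λ (v≡u , _) → loopless vu v≡u)) ◅ ε)

  bridges⇒tree : IsTree F
  bridges⇒tree = underlyingGraph
    , record { nonempty = root ; connected = λ u v → star (F-connected u v) ; acyclic = no-cycle }
    , record { underlying = λ u v → mk⇔ (edge⁻ u v) (edge⁺ u v) ; oneDirection = one-direction }

module _ {Fs : List Digraph} {H : Digraph} (complete : IsCompleteSetOfObstructions (_∈ Fs) H)
         (connected : ∀ {F} → F ∈ Fs → Connected F) (rigid : ∀ {F} → F ∈ Fs → Rigid F) where

  private
    common-radius : ∃[ r ] (∀ {F} → F ∈ Fs → Radius r F)
    common-radius = uniform-bound {P = Radius}
      (λ m≤n radius a b → let w , w≤ = radius a b in w , ℕ.≤-trans w≤ m≤n)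
      Fs (connected⇒radius ∘ connected)

    below : Digraph → ℕ
    below A = length (filter (λ F → hom? F A) Fs)

    -- Obstructions minimal in the homomorphism order are trees.
    descend : ∀ n {A} → below A ≤ n → A ∈ Fs → ∃[ T ] IsTree T × T ⟶ A × T ↮ H

    -- The lift gives `F ⟶ A`, while the bypass forbids `A ⟶ F`. Hence whatever maps to `F` maps to
    -- `A`, but `A` itself does not map to `F`, and the count `below` drops.
    descend-bypassed : ∀ n {A} → below A ≤ n → A ∈ Fs → ∀ {u v} → Bypassed A u v →
                       ∃[ F ] F ∈ Fs × Lift F A u v → ∃[ T ] IsTree T × T ⟶ A × T ↮ H

    descend n {A} A≤ A∈ = decide (any? λ u → any? λ v → bypassed? A u v)
      where
      A↮H = obstruction-↮ complete A∈

      decide : Dec (∃[ u ] ∃[ v ] Bypassed A u v) → ∃[ T ] IsTree T × T ⟶ A × T ↮ H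
      decide (no bridges)       = A
        , bridges⇒tree A (inhabitant A↮H) (connected A∈) (λ u v b → bridges (u , v , b))
        , idₕ , A↮H
      decide (yes (u , v , b)) = descend-bypassed n A≤ A∈ b
        (lift-exists complete (proj₂ common-radius) A↮H u v)

    descend-bypassed n {A} A≤ A∈ b (F , F∈ , ℒ)
      with n | ℕ.<-≤-trans (length-filter-mono-< (λ X → hom? X F) (λ X → hom? X A) (Lift.hom ℒ ∘ₕ_)
                              A∈ idₕ (bypassed⇒↮ (rigid A∈) b ℒ)) A≤
    ... | suc m | F<A =
      let T , T-tree , T⟶F , T↮H = descend m (ℕ.≤-pred F<A) F∈ in T , T-tree , Lift.hom ℒ ∘ₕ T⟶F , T↮H

  tree-below : ∀ {A} → A ∈ Fs → ∃[ T ] IsTree T × T ⟶ A × T ↮ H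
  tree-below = descend _ ℕ.≤-refl

module _ {A B : Set} {Q : A → B → Set} where

  -- Finite choice, keeping the correspondence in both directions.
  images : ∀ xs → (∀ {x} → x ∈ xs → ∃[ y ] Q x y) →
           ∃[ ys ] (∀ {y} → y ∈ ys → ∃[ x ] x ∈ xs × Q x y) × (∀ {x} → x ∈ xs → ∃[ y ] y ∈ ys × Q x y)
  images []       _     = [] , (λ ()) , λ ()
  images (x ∷ xs) image =
    let y , q = image (here refl) ; ys , back , forth = images xs (image ∘ there)
    in y ∷ ys
      , (λ { (here refl) → x , here refl , q ; (there y∈) → let x , x∈ , q = back y∈ in x , there x∈ , q })
      , (λ { (here refl) → y , here refl , q ; (there x∈) → let y , y∈ , q = forth x∈ in y , there y∈ , q })

refine-obstructions : ∀ {Fs Ts H} → IsCompleteSetOfObstructions (_∈ Fs) H → (∀ {T} → T ∈ Ts → T ↮ H) →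
                      (∀ {F} → F ∈ Fs → ∃[ T ] T ∈ Ts × T ⟶ F) → IsCompleteSetOfObstructions (_∈ Ts) H
refine-obstructions complete obstructs finer G = mk⇔
  (λ G⟶H T T∈ T⟶G → obstructs T∈ (G⟶H ∘ₕ T⟶G))
  (λ T↮G → from (complete G) λ F F∈ F⟶G → let T , T∈ , T⟶F = finer F∈ in T↮G T T∈ (F⟶G ∘ₕ T⟶F))

-- Connected cores come first, since the descent uses connectedness to bound walks and rigidity to
-- obtain sections; the obstructions it meets must again come from that list.
finiteDuality⇒trees : ∀ {H} → HasFiniteDuality H →
  ∃[ Ts ] (∀ {T} → T ∈ Ts → IsTree T) × IsCompleteSetOfObstructions (_∈ Ts) H
finiteDuality⇒trees {H} (Fs , Fs-complete) =
  let Cs , C-props , core-of = images Fs λ {F} F∈ →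
        connectedCore _ F ℕ.≤-refl (obstruction-↮ Fs-complete F∈)
      Cs-complete = refine-obstructions Fs-complete
        (λ C∈ → let _ , _ , _ , C↮H , _ = C-props C∈ in C↮H)
        (λ F∈ → let C , C∈ , C⟶F , _ = core-of F∈ in C , C∈ , C⟶F)
      Ts , T-props , tree-of = images Cs (tree-below Cs-complete
        (λ C∈ → let _ , _ , _ , _ , connected , _ = C-props C∈ in connected)
        (λ C∈ → let _ , _ , _ , _ , _ , rigid = C-props C∈ in rigid))
  in Ts , (λ T∈ → let _ , _ , T-tree , _ = T-props T∈ in T-tree)
    , refine-obstructions Cs-complete
        (λ T∈ → let _ , _ , _ , _ , T↮H = T-props T∈ in T↮H)
        (λ C∈ → let T , T∈ , _ , T⟶C , _ = tree-of C∈ in T , T∈ , T⟶C)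

-- Products, duals of finite sets of trees, and the transfer along the template

module Product (G H : Digraph) where

  module D = CodeDigraph {R = λ (u , x) (v , y) → Arc G u v × Arc H x y}
    (order G * order H) (remQuot (order H)) (λ (u , x) (v , y) → T? (arc G u v) ×-dec T? (arc H x y))

  product : Digraph
  product = D.digraph

  product-universal : ∀ X → (X ⟶ product) ⇔ ((X ⟶ G) × (X ⟶ H))
  product-universal X = mk⇔
    (λ φ → record { fun       = λ x → proj₁ (remQuot {order G} (order H) (fun φ x))
                  ; preserves = λ a → proj₁ (D.arc⁻ _ _ (preserves φ a)) }
         , record { fun       = λ x → proj₂ (remQuot {order G} (order H) (fun φ x))
                  ; preserves = λ a → proj₂ (D.arc⁻ _ _ (preserves φ a)) })
    (λ (φ , ψ) → record
      { fun       = λ x → combine (fun φ x) (fun ψ x)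
      ; preserves = λ {x} {y} a → D.arc⁺ (combine (fun φ x) (fun ψ x)) (combine (fun φ y) (fun ψ y))
          (subst₂ (λ (u , x) (v , y) → Arc G u v × Arc H x y)
            (sym (remQuot-combine (fun φ x) (fun ψ x))) (sym (remQuot-combine (fun φ y) (fun ψ y)))
            (preserves φ a , preserves ψ a)) })

trees⇒dual : ∀ Ts → (∀ {T} → T ∈ Ts → IsTree T) → ∃[ K ] IsCompleteSetOfObstructions (_∈ Ts) K
-- With nothing to avoid, the dual is a single loop, the terminal digraph.
trees⇒dual []       _     = record { order = 1 ; arc = λ _ _ → true } , λ G →
  mk⇔ (λ _ _ ()) (λ _ → record { fun = λ _ → zero ; preserves = λ _ → tt })
trees⇒dual (T ∷ Ts) trees =
  let U , tree , orientation = trees (here refl)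
      K , K-complete = trees⇒dual Ts (trees ∘ there)
      open Dual T U tree orientation
      open Product dual K
  in product , λ G → mk⇔
    (λ G⟶K′ → let G⟶dual , G⟶K = to (product-universal G) G⟶K′ in
      λ { _ (here refl) → to (dual-duality G) G⟶dual ; F (there F∈) → to (K-complete G) G⟶K F F∈ })
    (λ F↮G → from (product-universal G)
      ( from (dual-duality G) (F↮G T (here refl))
      , from (K-complete G) (λ F F∈ → F↮G F (there F∈))))

-- `K` is the dual of trees `L` equivalent to the `Λ 𝒯 T`. By the adjunction, an `L` maps to `G`
-- exactly when the corresponding `T` maps to `Γ 𝒯 G`, so both sides of the property exclude the
-- same digraphs.
Λ-finiteDuality : ∀ 𝒯 → (∀ T → IsTree T → EquivalentToTree (Λ 𝒯 T)) → ∀ {H} → HasFiniteDuality H →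
                  ∃[ K ] Property⋆ 𝒯 H K × HasFiniteDuality K
Λ-finiteDuality 𝒯 Λ-tree {H} H-finite =
  let Ts , trees , Ts-complete = finiteDuality⇒trees H-finite
      Ls , L-props , L-of = images {Q = λ T L → IsTree L × Λ 𝒯 T ≃ₕ L} Ts (λ {T} T∈ → Λ-tree T (trees T∈))
      K , Ls-complete = trees⇒dual Ls (λ L∈ → let _ , _ , L-tree , _ = L-props L∈ in L-tree)
  in K
    , (λ G → mk⇔
        (λ ΓG⟶H → from (Ls-complete G) λ L L∈ L⟶G →
          let T , T∈ , _ , ΛT⟶L , _ = L-props L∈
          in to (Ts-complete (Γ 𝒯 G)) ΓG⟶H T T∈ (Λ⟶⇒⟶Γ 𝒯 (L⟶G ∘ₕ ΛT⟶L)))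
        (λ G⟶K → from (Ts-complete (Γ 𝒯 G)) λ T T∈ T⟶ΓG →
          let L , L∈ , _ , _ , L⟶ΛT = L-of T∈
          in to (Ls-complete G) G⟶K L L∈ (⟶Γ⇒Λ⟶ 𝒯 T⟶ΓG ∘ₕ L⟶ΛT)))
    , Ls , Ls-complete

theorem8p2 : (𝒯 : PultrTemplate) (𝓕 : Pred Digraph 0ℓ) (H : Digraph) → IsCompleteSetOfObstructions 𝓕 H →
    (∀ K → Property⋆ 𝒯 H K → IsCompleteSetOfObstructions (Λ-image 𝒯 𝓕) K)
    × (EquivalentToTree (PultrTemplate.P 𝒯) → EquivalentToTree (PultrTemplate.Q 𝒯) →
    (∀ T → IsTree T → EquivalentToTree (Λ 𝒯 T)) →
    (HasTreeDuality H → ∀ K → Property⋆ 𝒯 H K → HasTreeDuality K)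
    × (HasFiniteDuality H → ∃[ K ] Property⋆ 𝒯 H K × HasFiniteDuality K))
theorem8p2 𝒯 𝓕 H complete =
    (λ K → Λ-image-complete 𝒯 complete)
  , λ _ _ Λ-tree → (λ H-tree K → Λ-treeDuality 𝒯 Λ-tree H-tree) , Λ-finiteDuality 𝒯 Λ-tree
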